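{- (1) There exist recursive sets $A,B$ such that $A\le_T^{SN}B$ and $A\not\le_T^{O}B$; indeed, this can be achieved with $B$ a recursive sparse set and $A$ a recursive tally set. (2) There exist recursive sets $A,B$ such that $A\le_T^{SN}B$ and $A\not\le_T^{U}B$; indeed, this can be achieved with $B$ a recursive sparse set and $A$ a recursive tally set.
   Context: Sets are languages over $\{0,1\}$. A set $S$ is sparse if there is a polynomial $r$ with $|S\cap\Sigma^{\le n}|\le r(n)$ for all $n$; a tally set is a subset of $\{0\}^*$. An NPTM is a nondeterministic oracle Turing machine $N$ each of whose computation paths ends in one of three outcomes $\mathbf{acc}$, $\mathbf{rej}$, $\mathbf{?}$, such that there is a polynomial $p$ with: for every oracle $D$ and every input $x$, every computation path of $N^D(x)$ has length at most $p(|x|)$. For an oracle $D$ and input $x$, let $out_{N^D}(x)$ be the set of outcomes occurring on some path of $N^D(x)$; $L(N^D)=\{x:\mathbf{acc}\in out_{N^D}(x)\}$. $N^D(x)$ is underproductive if $\{\mathbf{acc},\mathbf{rej}\}\not\subseteq out_{N^D}(x)$, and overproductive if $out_{N^D}(x)\neq\{\mathbf{?}\}$; $N^D$ is underproductive (overproductive) if $N^D(x)$ is so for every $x$. $N$ is robustly underproductive (overproductive) if $N^D$ is underproductive (overproductive) for every oracle $D$. $A\le_T^{SN}B$ if there is an NPTM $N$ with $N^B$ both overproductive and underproductive and $A=L(N^B)$. $A\le_T^{U}B$ if $A\le_T^{SN}B$ via an $N$ that is robustly underproductive. $A\le_T^{O}B$ if $A\le_T^{SN}B$ via an $N$ that is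 robustly overproductive. -}

module Defs where

open import Data.Nat using (ℕ; zero; suc; _+_; _*_; _≤_)
open import Data.Bool using (Bool; true; false)
open import Data.Fin using (Fin; zero; suc)
open import Data.List using (List; []; _∷_; length; map)
open import Data.List.NonEmpty using (List⁺; toList) renaming (tail to tail⁺)
open import Data.List.Membership.Propositional using (_∈_)
open import Data.List.Relation.Unary.All using (All)
open import Data.List.Relation.Unary.Unique.Propositional using (Unique)
open import Data.Maybe using (Maybe; just; nothing)
open import Data.Product using (Σ; _×_; _,_)
open import Data.Sum using (_⊎_; inj₁; inj₂)
open import Data.Empty using (⊥)
open import Relation.Nullary using (¬_)
open import Relation.Binary.PropositionalEquality using (_≡_)

-- Strings over {0,1} (0 = false, 1 = true) and languages

Str : Set
Str = List Bool

Lang : Set₁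
Lang = Str → Set

Poly : Set
Poly = List ℕ

eval : Poly → ℕ → ℕ
eval []       n = 0
eval (a ∷ as) n = a + n * eval as n

Sparse : Lang → Set
Sparse S = Σ Poly λ r → ∀ (n : ℕ) (ws : List Str) → Unique ws →
  All (λ w → S w × length w ≤ n) ws → length ws ≤ eval r n

Tally : Lang → Set
Tally A = ∀ w → A w → All (_≡ false) w

-- Nondeterministic oracle Turing machines (single one-way-infinite
-- tape, tape alphabet Fin (3 + k): 0 = blank, 1 = bit 0, 2 = bit 1).
-- Oracle queries: in the query state the machine asks the oracle about
-- the maximal bit-string starting at the head position and moves to
-- the answer state ans true / ans false.

data Outcome : Set where
  acc rej ?? : Outcome

data Move : Set where
  L R S : Move

-- control states in which the machine reads and applies its
-- (nondeterministic) transition function: ordinary states Fin n and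
-- the two oracle-answer states (inj₂ true / inj₂ false)
Ctrl : ℕ → Set
Ctrl n = Fin n ⊎ Bool

data State (n : ℕ) : Set where
  ctrl : Ctrl n → State n
  qry  : State n
  halt : Outcome → State n

Sym : ℕ → Set
Sym k = Fin (3 + k)

blank : ∀ {k} → Sym k
blank = zero

enc : ∀ {k} → Bool → Sym k
enc false = suc zero
enc true  = suc (suc zero)

bit? : ∀ {k} → Sym k → Maybe Bool
bit? zero             = nothing
bit? (suc zero)       = just false
bit? (suc (suc zero)) = just true
bit? (suc (suc (suc _))) = nothing

query : ∀ {k} → List (Sym k) → Str
query [] = []
query (a ∷ r) with bit? a
... | just b  = b ∷ query r
... | nothing = []

-- transition function always offers at least one choice, so the only
-- paths that end are those reaching a halting state
record Machine : Set where
  field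
    nst   : ℕ
    k     : ℕ
    start : Ctrl nst
    δ     : Ctrl nst → Sym k → List⁺ (State nst × Sym k × Move)
open Machine public

-- configuration: state, tape left of head (reversed), tape from head on
Config : Machine → Set
Config M = State (nst M) × List (Sym (k M)) × List (Sym (k M))

initial : (M : Machine) → Str → Config M
initial M x = ctrl (start M) , [] , map enc x

headSym : ∀ {k} → List (Sym k) → Sym k
headSym []      = blank
headSym (a ∷ _) = a

tailL : ∀ {A : Set} → List A → List A
tailL []      = []
tailL (_ ∷ r) = r

apply : (M : Machine) → State (nst M) × Sym (k M) × Move →
        List (Sym (k M)) → List (Sym (k M)) → Config M
apply M (s , a , L) []      r = s , [] , a ∷ tailL r
apply M (s , a , L) (b ∷ l) r = s , l , b ∷ a ∷ tailL r
apply M (s , a , R) l       r = s , a ∷ l , tailL r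
apply M (s , a , S) l       r = s , l , a ∷ tailL r

data Step (M : Machine) (D : Lang) : Config M → Config M → Set where
  trans : ∀ {c l r t} → t ∈ toList (δ M c (headSym r)) →
          Step M D (ctrl c , l , r) (apply M t l r)
  yes   : ∀ {l r} → D (query r) →
          Step M D (qry , l , r) (ctrl (inj₂ true) , l , r)
  no    : ∀ {l r} → ¬ D (query r) →
          Step M D (qry , l , r) (ctrl (inj₂ false) , l , r)

data Reach (M : Machine) (D : Lang) : Config M → ℕ → Config M → Set where
  here : ∀ {c} → Reach M D c 0 c
  next : ∀ {c c' c'' t} → Step M D c c' → Reach M D c' t c'' →
         Reach M D c (suc t) c''

Out : Machine → Lang → Str → Outcome → Set
Out M D x o = Σ ℕ λ t → Σ (List (Sym (k M)) × List (Sym (k M))) λ rest →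
  Reach M D (initial M x) t (halt o , rest)

record NPTM : Set₁ where
  field
    machine : Machine
    bound   : Poly
    timed   : ∀ (D : Lang) (x : Str) (t : ℕ) (c : Config machine) →
              Reach machine D (initial machine x) t c → t ≤ eval bound (length x)
open NPTM public

Underproductive : NPTM → Lang → Set
Underproductive N D = ∀ x →
  ¬ (Out (machine N) D x acc × Out (machine N) D x rej)

-- out ≠ {?} (out is always nonempty since every path ends in an outcome)
Overproductive : NPTM → Lang → Set
Overproductive N D = ∀ x →
  ¬ (¬ Out (machine N) D x acc × ¬ Out (machine N) D x rej)

RobustlyUnderproductive : NPTM → Set₁
RobustlyUnderproductive N = ∀ D → Underproductive N D

RobustlyOverproductive : NPTM → Set₁
RobustlyOverproductive N = ∀ D → Overproductive N D

SNvia : NPTM → Lang → Lang → Set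
SNvia N A B = Overproductive N B × Underproductive N B ×
  (∀ x → (A x → Out (machine N) B x acc) × (Out (machine N) B x acc → A x))

_≤SN_ : Lang → Lang → Set₁
A ≤SN B = Σ NPTM λ N → SNvia N A B

_≤U_ : Lang → Lang → Set₁
A ≤U B = Σ NPTM λ N → RobustlyUnderproductive N × SNvia N A B

_≤O_ : Lang → Lang → Set₁
A ≤O B = Σ NPTM λ N → RobustlyOverproductive N × SNvia N A B

-- Recursive sets: decided by a deterministic machine of the above kind
-- (the oracle is never consulted meaningfully; we fix the empty oracle)

Deterministic : Machine → Set
Deterministic M = ∀ c a → tail⁺ (δ M c a) ≡ []

∅ : Lang
∅ _ = ⊥

Recursive : Lang → Set
Recursive A = Σ Machine λ M → Deterministic M × (∀ x →
  (A x × Out M ∅ x acc) ⊎ (¬ A x × Out M ∅ x rej))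

{-# OPTIONS --safe #-}

-- One pair A, B serves both parts. B contains exactly one string w n of each length n, and
-- 0ⁿ belongs to A if w n starts with 1. Guessing a string of length n, asking whether it is
-- in B, and giving its first bit as verdict is an SN-reduction of A to B.
-- At a stage of length n for a machine N, let w n be some string w for which N errs on 0ⁿ
-- with w as the only oracle string of length n (N is simulated for 2ⁿ steps). Lengths up to
-- n + 2ⁿ then get the string 0…0, so N errs with oracle B too. If N is right for every w and
-- n is large, N is not robust: without strings of length n in the oracle, a path with verdict
-- b would miss some w starting with 1 - b, so N never gives a verdict; and a path accepting for some 1y and
-- a path rejecting for some 0z can be chosen not to query each other's word, so that N both
-- accepts and rejects once both words are in the oracle.
-- A and B are recursive since the construction is a program in a small typed language,
-- compiled through functions on codes of lists and register programs to Turing machines.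

module Submission where

open import Defs
open import Data.Bool using (Bool; true; false; not; _∧_; _∨_; _xor_; if_then_else_)
open import Data.Bool.ListAction using (any)
open import Data.Bool.Properties using (T-≡)
open import Data.Empty using (⊥; ⊥-elim)
open import Data.Fin using (Fin; zero; suc; toℕ; _↑ˡ_; _↑ʳ_; splitAt; combine; remQuot)
open import Data.Fin.Properties using (toℕ-injective; splitAt-↑ˡ; splitAt-↑ʳ; remQuot-combine)
open import Data.List using (List; []; _∷_; _++_; _ʳ++_; allFin; cartesianProduct; concatMap; drop;
  foldl; foldr; length; map; replicate; reverse; take)
open import Data.List.Membership.Propositional using (_∈_; _∉_; find; lose)
open import Data.List.Membership.Propositional.Properties using (∈-∃++; ∈-++⁺ˡ; ∈-++⁺ʳ; ∈-++⁻; ∈-map⁺;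
  ∈-map⁻; ∈-allFin; ∈-cartesianProduct⁺; ∈-concatMap⁺; ∈-concatMap⁻)
open import Data.List.NonEmpty using (List⁺; toList) renaming (_∷_ to _∷⁺_)
open import Data.List.Properties using (length-++; length-map; length-replicate; length-take; map-id; map-∘;
  map-cong; map-injective; map-is-foldr; concatMap-map; map-concatMap; concatMap-cong; reverse-foldl;
  reverse-involutive; take++drop≡id; ∷-injectiveʳ)
open import Data.List.Relation.Unary.All using (All; []; _∷_) renaming (lookup to All-lookup)
open import Data.List.Relation.Unary.AllPairs using ([]; _∷_)
open import Data.List.Relation.Unary.Any using (here; there)
open import Data.List.Relation.Unary.Unique.Propositional using (Unique)
import Data.List.Relation.Unary.Unique.Propositional.Properties as Unique
open import Data.Maybe using (Maybe; just; nothing; maybe) renaming (map to mapMaybe)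
open import Data.Nat using (ℕ; zero; suc; pred; _+_; _*_; _∸_; _^_; _≤_; _<_; z≤n; s≤s; _<ᵇ_; _≡ᵇ_)
open import Data.Nat.DivMod using (_/_; _%_; m≡m%n+[m/n]*n; m%n<n; /-monoˡ-≤; m*n/n≡m)
open import Data.Nat.Properties
open import Data.Product using (Σ; ∃; _×_; _,_; proj₁; proj₂; map₁)
open import Data.Sum using (_⊎_; inj₁; inj₂)
open import Data.Unit using (⊤; tt)
open import Data.Vec using (Vec; []; _∷_; lookup; _[_]≔_) renaming (map to mapᵛ; replicate to replicateᵛ)
open import Data.Vec.Properties using (lookup-map; lookup∘update; lookup∘update′; []≔-idempotent;
  []≔-commutes; []≔-lookup)
open import Function using (_∘_; id; flip; Equivalence)
open import Relation.Nullary using (¬_)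
open import Relation.Binary.PropositionalEquality using (_≡_; _≢_; refl; sym; cong; cong₂; subst; module ≡-Reasoning)
  renaming (trans to ≡-trans)

-- Structured Turing machine programs

-- The stages run through all numbers as machine codes, with no time bound attached to any of them.
-- The clock of 2ⁿ steps stands in for the unknown polynomial: it may cut a run off at an early
-- stage, and then the test can misjudge the machine, but every code recurs at arbitrarily late
-- stages and the argument uses a single late one. To err on 0ⁿ includes giving both verdicts and
-- giving neither. One Boolean test therefore covers every way in which a machine can fail as a
-- reduction, and one construction serves both parts. Because the test is Boolean, it also turns the
-- doubly negated information in `Overproductive` into an actual rejecting path. `Recursive` asks
-- for an explicit deterministic machine. All simulations being clocked, bounded folds over lists
-- express the whole construction, and unbounded loops occur only in the layers below, as register
-- and tape loops.

Tape : ℕ → Set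
Tape k = List (Sym k) × List (Sym k)

scan : ∀ {k} → Tape k → Sym k
scan (_ , r) = headSym r

move : ∀ {k} → Sym k × Move → Tape k → Tape k
move (a , L) ([] , r)    = [] , a ∷ tailL r
move (a , L) (b ∷ l , r) = l , b ∷ a ∷ tailL r
move (a , R) (l , r)     = a ∷ l , tailL r
move (a , S) (l , r)     = l , a ∷ tailL r

-- A test rewrites the scanned symbol, which materialises a blank beyond the end.
touch : ∀ {k} → Tape k → Tape k
touch t = move (scan t , S) t

data Cmd (k : ℕ) : Set where
  act   : (Sym k → Sym k × Move) → Cmd k
  _⨾_   : Cmd k → Cmd k → Cmd k
  while : (Sym k → Bool) → Cmd k → Cmd k
  cond  : (Sym k → Bool) → Cmd k → Cmd k → Cmd k

infixr 5 _⨾_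

data Run {k} : Cmd k → Tape k → Tape k → Set where
  act   : ∀ {f t} → Run (act f) t (move (f (scan t)) t)
  _⨾_   : ∀ {c d t u v} → Run c t u → Run d u v → Run (c ⨾ d) t v
  stop  : ∀ {p c t} → p (scan t) ≡ false → Run (while p c) t (touch t)
  loop  : ∀ {p c t u v} → p (scan t) ≡ true → Run c (touch t) u →
          Run (while p c) u v → Run (while p c) t v
  left  : ∀ {p c d t u} → p (scan t) ≡ true → Run c (touch t) u → Run (cond p c d) t u
  right : ∀ {p c d t u} → p (scan t) ≡ false → Run d (touch t) u → Run (cond p c d) t u

-- Only actions and tests occupy a control state. Passing from `c` to `d` in `c ⨾ d` is merged into
-- the last step of `c`.
Pos : ∀ {k} → Cmd k → Set
Pos (act f)      = ⊤
Pos (c ⨾ d)      = Pos c ⊎ Pos d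
Pos (while p c)  = Maybe (Pos c)
Pos (cond p c d) = Maybe (Pos c ⊎ Pos d)

entry : ∀ {k} (c : Cmd k) → Pos c
entry (act f)      = tt
entry (c ⨾ d)      = inj₁ (entry c)
entry (while p c)  = nothing
entry (cond p c d) = nothing

-- The next position `nothing` means that the command is finished.
step : ∀ {k} (c : Cmd k) → Pos c → Sym k → Maybe (Pos c) × Sym k × Move
step (act f) _ a = nothing , f a
step (c ⨾ d) (inj₁ q) a = map₁ (just ∘ maybe inj₁ (inj₂ (entry d))) (step c q a)
step (c ⨾ d) (inj₂ q) a = map₁ (mapMaybe inj₂) (step d q a)
step (while p c) nothing a = (if p a then just (just (entry c)) else nothing) , a , S
step (while p c) (just q) a = map₁ just (step c q a)
step (cond p c d) nothing a =
  just (just (if p a then inj₁ (entry c) else inj₂ (entry d))) , a , S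
step (cond p c d) (just (inj₁ q)) a = map₁ (mapMaybe (just ∘ inj₁)) (step c q a)
step (cond p c d) (just (inj₂ q)) a = map₁ (mapMaybe (just ∘ inj₂)) (step d q a)

size : ∀ {k} → Cmd k → ℕ
size (act f)      = 1
size (c ⨾ d)      = size c + size d
size (while p c)  = suc (size c)
size (cond p c d) = suc (size c + size d)

toFin : ∀ {k} (c : Cmd k) → Pos c → Fin (size c)
toFin (act f) _ = zero
toFin (c ⨾ d) (inj₁ q) = toFin c q ↑ˡ size d
toFin (c ⨾ d) (inj₂ q) = size c ↑ʳ toFin d q
toFin (while p c) nothing = zero
toFin (while p c) (just q) = suc (toFin c q)
toFin (cond p c d) nothing = zero
toFin (cond p c d) (just (inj₁ q)) = suc (toFin c q ↑ˡ size d)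
toFin (cond p c d) (just (inj₂ q)) = suc (size c ↑ʳ toFin d q)

fromFin : ∀ {k} (c : Cmd k) → Fin (size c) → Pos c
fromSum : ∀ {k} (c d : Cmd k) → Fin (size c) ⊎ Fin (size d) → Pos c ⊎ Pos d

fromSum c d (inj₁ i) = inj₁ (fromFin c i)
fromSum c d (inj₂ i) = inj₂ (fromFin d i)

fromFin (act f) _ = tt
fromFin (c ⨾ d) i = fromSum c d (splitAt (size c) i)
fromFin (while p c) zero = nothing
fromFin (while p c) (suc i) = just (fromFin c i)
fromFin (cond p c d) zero = nothing
fromFin (cond p c d) (suc i) = just (fromSum c d (splitAt (size c) i))

fromFin-toFin : ∀ {k} (c : Cmd k) (q : Pos c) → fromFin c (toFin c q) ≡ q
fromFin-toFin (act f) _ = refl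
fromFin-toFin (c ⨾ d) (inj₁ q) rewrite splitAt-↑ˡ (size c) (toFin c q) (size d) =
  cong inj₁ (fromFin-toFin c q)
fromFin-toFin (c ⨾ d) (inj₂ q) rewrite splitAt-↑ʳ (size c) (size d) (toFin d q) =
  cong inj₂ (fromFin-toFin d q)
fromFin-toFin (while p c) nothing = refl
fromFin-toFin (while p c) (just q) = cong just (fromFin-toFin c q)
fromFin-toFin (cond p c d) nothing = refl
fromFin-toFin (cond p c d) (just (inj₁ q)) rewrite splitAt-↑ˡ (size c) (toFin c q) (size d) =
  cong (just ∘ inj₁) (fromFin-toFin c q)
fromFin-toFin (cond p c d) (just (inj₂ q)) rewrite splitAt-↑ʳ (size c) (size d) (toFin d q) =
  cong (just ∘ inj₂) (fromFin-toFin d q)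

Reaches : (M : Machine) → Lang → Config M → Config M → Set
Reaches M D c c' = ∃ λ t → Reach M D c t c'

Reach-trans : ∀ {M D c c' c'' s t} → Reach M D c s c' → Reach M D c' t c'' →
              Reach M D c (s + t) c''
Reach-trans here ρ = ρ
Reach-trans (next σ ρ) ρ' = next σ (Reach-trans ρ ρ')

Reaches-trans : ∀ {M D c c' c''} → Reaches M D c c' → Reaches M D c' c'' → Reaches M D c c''
Reaches-trans (_ , ρ) (_ , ρ') = _ , Reach-trans ρ ρ'

apply-move : ∀ M s x l r → apply M (s , x) l r ≡ (s , move x (l , r))
apply-move M s (a , L) [] r = refl
apply-move M s (a , L) (b ∷ l) r = refl
apply-move M s (a , R) l r = refl
apply-move M s (a , S) l r = refl

δ-step : ∀ {M D c t s x} → δ M c (scan t) ≡ (s , x) ∷⁺ [] →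
         Step M D (ctrl c , t) (s , move x t)
δ-step {M} {D} {c} {l , r} {s} {x} eq =
  subst (Step M D (ctrl c , l , r)) (apply-move M s x l r)
    (trans (subst (λ ts → (s , x) ∈ toList ts) (sym eq) (here refl)))

target : ∀ {n} {P : Set} → (P → Fin n) → State n → Maybe P → State n
target κ e nothing  = e
target κ e (just q) = ctrl (inj₁ (κ q))

module _ (M : Machine) (D : Lang) where

  -- Subcommands run inside the same machine. With an arbitrary placement `κ` of the positions among
  -- its states and an arbitrary exit state `e`, the induction in `Run⇒Reaches` never changes the
  -- machine.
  Implements : (c : Cmd (k M)) → (Pos c → Fin (nst M)) → State (nst M) → Set
  Implements c κ e = ∀ q a →
    δ M (inj₁ (κ q)) a ≡ map₁ (target κ e) (step c q a) ∷⁺ []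

  private
    single : ∀ c {κ e} → Implements c κ e → ∀ q {t} →
             Step M D (ctrl (inj₁ (κ q)) , t)
               (target κ e (proj₁ (step c q (scan t))) ,
                move (proj₂ (step c q (scan t))) t)
    single c impl q {t} = δ-step {t = t} (impl q (scan t))

    restrict : ∀ c {κ e} c' (f : Pos c' → Pos c) (φ : Maybe (Pos c') → Maybe (Pos c)) {e'} →
               (∀ q a → step c (f q) a ≡ map₁ φ (step c' q a)) →
               (∀ m → target κ e (φ m) ≡ target (κ ∘ f) e' m) →
               Implements c κ e → Implements c' (κ ∘ f) e'
    restrict c c' f φ step-f exit impl q a
      rewrite impl (f q) a | step-f q a | exit (proj₁ (step c' q a)) = refl

  Run⇒Reaches : ∀ c {κ e} → Implements c κ e → ∀ {t u} → Run c t u →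
                Reaches M D (ctrl (inj₁ (κ (entry c))) , t) (e , u)
  Run⇒Reaches (act f) impl act = 1 , next (single (act f) impl tt) here
  Run⇒Reaches (c ⨾ d) {κ} impl (ρ ⨾ σ) =
    Reaches-trans
      (Run⇒Reaches c {κ ∘ inj₁} (restrict (c ⨾ d) {κ} c inj₁ (just ∘ maybe inj₁ (inj₂ (entry d)))
        (λ _ _ → refl) (λ { (just _) → refl ; nothing → refl }) impl) ρ)
      (Run⇒Reaches d {κ ∘ inj₂} (restrict (c ⨾ d) {κ} d inj₂ (mapMaybe inj₂)
        (λ _ _ → refl) (λ { (just _) → refl ; nothing → refl }) impl) σ)
  Run⇒Reaches (while p c) {κ} impl {t} (stop eq) with single (while p c) {κ} impl nothing {t}
  ... | σ rewrite eq = 1 , next σ here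
  Run⇒Reaches (while p c) {κ} impl {t} (loop eq ρ τ) with single (while p c) {κ} impl nothing {t}
  ... | σ rewrite eq =
    Reaches-trans (1 , next σ here)
      (Reaches-trans
        (Run⇒Reaches c {κ ∘ just} (restrict (while p c) {κ} c just just
          (λ _ _ → refl) (λ { (just _) → refl ; nothing → refl }) impl) ρ)
        (Run⇒Reaches (while p c) impl τ))
  Run⇒Reaches (cond p c d) {κ} impl {t} (left eq ρ) with single (cond p c d) {κ} impl nothing {t}
  ... | σ rewrite eq =
    Reaches-trans (1 , next σ here)
      (Run⇒Reaches c {κ ∘ just ∘ inj₁} (restrict (cond p c d) {κ} c (just ∘ inj₁) (mapMaybe (just ∘ inj₁))
        (λ _ _ → refl) (λ { (just _) → refl ; nothing → refl }) impl) ρ)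
  Run⇒Reaches (cond p c d) {κ} impl {t} (right eq ρ) with single (cond p c d) {κ} impl nothing {t}
  ... | σ rewrite eq =
    Reaches-trans (1 , next σ here)
      (Run⇒Reaches d {κ ∘ just ∘ inj₂} (restrict (cond p c d) {κ} d (just ∘ inj₂) (mapMaybe (just ∘ inj₂))
        (λ _ _ → refl) (λ { (just _) → refl ; nothing → refl }) impl) ρ)

verdict : Bool → Outcome
verdict true  = acc
verdict false = rej

-- State zero delivers the verdict; the oracle-answer states are never entered.
decider : ∀ {k} → Cmd k → (Sym k → Bool) → Machine
decider {k} c p = record
  { nst = suc (size c) ; k = k ; start = inj₁ (suc (toFin c (entry c)))
  ; δ = λ { (inj₁ zero)    a → (halt (verdict (p a)) , a , S) ∷⁺ []
          ; (inj₁ (suc i)) a →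
              map₁ (target (suc ∘ toFin c) (ctrl (inj₁ zero)))
                (step c (fromFin c i) a) ∷⁺ []
          ; (inj₂ _) a → (halt ?? , a , S) ∷⁺ [] } }

decider-deterministic : ∀ {k} (c : Cmd k) p → Deterministic (decider c p)
decider-deterministic c p (inj₁ zero) a = refl
decider-deterministic c p (inj₁ (suc i)) a = refl
decider-deterministic c p (inj₂ _) a = refl

decider-out : ∀ {k} (c : Cmd k) p D x {t} → Run c ([] , map enc x) t →
              Out (decider c p) D x (verdict (p (scan t)))
decider-out c p D x {t} ρ with
  Reaches-trans (Run⇒Reaches (decider c p) D c {suc ∘ toFin c}
    (λ q a → cong (λ q' → map₁ (target (suc ∘ toFin c) (ctrl (inj₁ zero)))
       (step c q' a) ∷⁺ []) (fromFin-toFin c q)) ρ)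
    (1 , next (δ-step {t = t} refl) here)
... | n , σ = n , _ , σ

-- Registers on tape tracks

-- The factor 2 stands on the right so that `combine` makes the head of a vector the least
-- significant bit.
pow2 : ℕ → ℕ
pow2 zero    = 1
pow2 (suc n) = pow2 n * 2

bit : Bool → Fin 2
bit false = zero
bit true  = suc zero

unbit : Fin 2 → Bool
unbit zero = false
unbit (suc zero) = true

unbit-bit : ∀ b → unbit (bit b) ≡ b
unbit-bit false = refl
unbit-bit true  = refl

packBits : ∀ {n} → Vec Bool n → Fin (pow2 n)
packBits []       = zero
packBits (b ∷ bs) = combine (packBits bs) (bit b)

unpackBits : ∀ n → Fin (pow2 n) → Vec Bool n
unpackBits zero    _ = []
unpackBits (suc n) i =
  unbit (proj₂ (remQuot {pow2 n} 2 i)) ∷ unpackBits n (proj₁ (remQuot {pow2 n} 2 i))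

unpack-pack : ∀ {n} (bs : Vec Bool n) → unpackBits n (packBits bs) ≡ bs
unpack-pack [] = refl
unpack-pack (b ∷ bs) = cong₂ _∷_
  (≡-trans (cong (unbit ∘ proj₂) inverse) (unbit-bit b))
  (≡-trans (cong (unpackBits _ ∘ proj₁) inverse) (unpack-pack bs))
  where inverse = remQuot-combine (packBits bs) (bit b)

Input : Set
Input = Bool × Bool

-- Low digit first, these pairs are the binary digits of the symbols: 0 for a blank, 1 and 2 for the
-- two bits. The remaining value 3 marks a bit already consumed.
noInput inputRead : Input
noInput   = false , false
inputRead = true , true

inputBit : Bool → Input
inputBit false = true , false
inputBit true  = false , true

record Cell : Set where
  constructor cell
  field
    mark   : Bool
    tracks : Vec Bool 6
    input  : Input
open Cell

-- 3 + extra = 2⁹, one bit for each track; the input track is the least significant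
-- one, so that blank, enc false and enc true are cells with empty registers.
extra : ℕ
extra = 509

private
  fromBits : Vec Bool 9 → Cell
  fromBits (lo ∷ hi ∷ m ∷ ts) = cell m ts (lo , hi)

abstract
  write : Cell → Sym extra
  write (cell m ts (lo , hi)) = packBits (lo ∷ hi ∷ m ∷ ts)

  read : Sym extra → Cell
  read a = fromBits (unpackBits 9 a)

  read-write : ∀ c → read (write c) ≡ c
  read-write (cell m ts (lo , hi)) = cong fromBits (unpack-pack (lo ∷ hi ∷ m ∷ ts))

  read-blank : read blank ≡ cell false (replicateᵛ 6 false) noInput
  read-blank = refl

  read-enc : ∀ b → read (enc b) ≡ cell false (replicateᵛ 6 false) (inputBit b)
  read-enc false = refl
  read-enc true  = refl

at : List (Sym extra) → ℕ → Sym extra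
at []      _       = blank
at (a ∷ r) zero    = a
at (a ∷ r) (suc j) = at r j

Left : (ℕ → Cell) → ℕ → List (Sym extra) → Set
Left f zero    []      = ⊤
Left f (suc m) (a ∷ l) = read a ≡ f m × Left f m l
Left f _       _       = ⊥

-- The tape reads f, and the head is in position m.
record Rep (f : ℕ → Cell) (m : ℕ) (t : Tape extra) : Set where
  constructor mkRep
  field
    leftOf  : Left f m (proj₁ t)
    rightOf : ∀ j → read (at (proj₂ t) j) ≡ f (m + j)

at-zero : ∀ r → at r 0 ≡ headSym r
at-zero []      = refl
at-zero (_ ∷ _) = refl

at-suc : ∀ r j → at (tailL r) j ≡ at r (suc j)
at-suc []      j = refl
at-suc (_ ∷ _) j = refl

scan-Rep : ∀ {f m t} → Rep f m t → read (scan t) ≡ f m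
scan-Rep {f} {m} {l , r} (mkRep _ rt) rewrite sym (at-zero r) =
  ≡-trans (rt 0) (cong f (+-identityʳ m))

_Except_≗_ : (ℕ → Cell) → ℕ → (ℕ → Cell) → Set
f Except m ≗ g = ∀ j → j ≢ m → f j ≡ g j

-- The offset `n` is there for the induction: the recursion runs away from the head while the
-- exceptional cell stays in place.
Left-local : ∀ {f g} n {m l} → f Except (n + m) ≗ g → Left f m l → Left g m l
Left-local n {zero} {[]} _ _ = tt
Left-local {f} {g} n {suc m} {a ∷ l} f≗g (eq , lf) =
  ≡-trans eq (f≗g m (m≢ n)) ,
  Left-local (suc n) (λ j j≢ → f≗g j (λ e → j≢ (≡-trans e (+-suc n m)))) lf
  where
  m≢ : ∀ n {m} → m ≢ n + suc m
  m≢ n {suc m} eq = m≢ n {m} (cong pred (≡-trans eq (+-suc n (suc m))))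
  m≢ (suc n) {zero} ()
  m≢ zero {zero} ()

Right-local : ∀ {f g m r} → f Except m ≗ g → (∀ j → read (at r j) ≡ f (m + j)) →
              ∀ j → read (at (tailL r) j) ≡ g (suc (m + j))
Right-local {f} {g} {m} {r} f≗g rt j rewrite at-suc r j =
  ≡-trans (rt (suc j)) (≡-trans (cong f (+-suc m j)) (f≗g _ (≢m m)))
  where
  ≢m : ∀ m → suc (m + j) ≢ m
  ≢m zero ()
  ≢m (suc m) eq = ≢m m (cong pred eq)

Right-cons : ∀ g m {a r} → read a ≡ g m → (∀ j → read (at r j) ≡ g (suc (m + j))) →
             ∀ j → read (at (a ∷ r) j) ≡ g (m + j)
Right-cons g m eq rt zero = ≡-trans eq (cong g (sym (+-identityʳ m)))
Right-cons g m eq rt (suc j) = ≡-trans (rt j) (cong g (sym (+-suc m j)))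

Rep-S : ∀ {f g m t a} → f Except m ≗ g → read a ≡ g m → Rep f m t → Rep g m (move (a , S) t)
Rep-S {g = g} {m} {l , r} f≗g eq (mkRep lf rt) =
  mkRep (Left-local 0 f≗g lf) (Right-cons g m eq (Right-local {r = r} f≗g rt))

Rep-R : ∀ {f g m t a} → f Except m ≗ g → read a ≡ g m → Rep f m t →
        Rep g (suc m) (move (a , R) t)
Rep-R {t = l , r} f≗g eq (mkRep lf rt) =
  mkRep (eq , Left-local 0 f≗g lf) (Right-local {r = r} f≗g rt)

m≢1+m : ∀ (m : ℕ) → m ≢ suc m
m≢1+m (suc m) eq = m≢1+m m (cong pred eq)

Rep-L : ∀ {f g m t a} → f Except suc m ≗ g → read a ≡ g (suc m) → Rep f (suc m) t →
        Rep g m (move (a , L) t)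
Rep-L {g = g} {m} {b ∷ l , r} f≗g eq (mkRep (eq' , lf) rt) =
  mkRep (Left-local 1 f≗g lf)
    (Right-cons g m (≡-trans eq' (f≗g m (m≢1+m m)))
      (Right-cons g (suc m) eq (Right-local {r = r} f≗g rt)))

-- Tapes with the same cells may differ in trailing blanks. Specifications are therefore about cell
-- functions and quantify over all tapes that represent them.
Does : Cmd extra → (ℕ → Cell) → ℕ → (ℕ → Cell) → ℕ → Set
Does c f m g n = ∀ {t} → Rep f m t → ∃ λ u → Run c t u × Rep g n u

edit : (Cell → Cell) → Move → Cmd extra
edit h d = act (λ a → write (h (read a)) , d)

private
  edited : ∀ {f m t v} h → Rep f m t → v ≡ h (f m) → read (write (h (read (scan t)))) ≡ v
  edited {f} {m} h rep eq =
    ≡-trans (read-write _) (≡-trans (cong h (scan-Rep rep)) (sym eq))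

edit-S : ∀ {f g m} h → f Except m ≗ g → g m ≡ h (f m) → Does (edit h S) f m g m
edit-S h f≗g eq rep = _ , act , Rep-S f≗g (edited h rep eq) rep

edit-R : ∀ {f g m} h → f Except m ≗ g → g m ≡ h (f m) → Does (edit h R) f m g (suc m)
edit-R h f≗g eq rep = _ , act , Rep-R f≗g (edited h rep eq) rep

edit-L : ∀ {f g m} h → f Except suc m ≗ g → g (suc m) ≡ h (f (suc m)) →
         Does (edit h L) f (suc m) g m
edit-L h f≗g eq rep = _ , act , Rep-L f≗g (edited h rep eq) rep

infixr 5 _⨾ᵈ_
_⨾ᵈ_ : ∀ {c d f g h m n o} → Does c f m g n → Does d g n h o → Does (c ⨾ d) f m h o
(C ⨾ᵈ D) rep with C rep
... | _ , ρ , rep' with D rep'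
... | _ , σ , rep'' = _ , (ρ ⨾ σ) , rep''

private
  tested : ∀ {f m t b} (p : Cell → Bool) → Rep f m t → p (f m) ≡ b → p (read (scan t)) ≡ b
  tested p rep eq = ≡-trans (cong p (scan-Rep rep)) eq

  Rep-touch : ∀ {f m t} → Rep f m t → Rep f m (touch t)
  Rep-touch rep = Rep-S (λ _ _ → refl) (scan-Rep rep) rep

whileᶜ : (Cell → Bool) → Cmd extra → Cmd extra
whileᶜ p = while (p ∘ read)

condᶜ : (Cell → Bool) → Cmd extra → Cmd extra → Cmd extra
condᶜ p = cond (p ∘ read)

stopᵈ : ∀ p {c f m} → p (f m) ≡ false → Does (whileᶜ p c) f m f m
stopᵈ p eq rep = _ , stop (tested p rep eq) , Rep-touch rep

loopᵈ : ∀ p {c f m g n h o} → p (f m) ≡ true → Does c f m g n →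
        Does (whileᶜ p c) g n h o → Does (whileᶜ p c) f m h o
loopᵈ p eq C W rep with C (Rep-touch rep)
... | _ , ρ , rep' with W rep'
... | _ , σ , rep'' = _ , loop (tested p rep eq) ρ σ , rep''

leftᵈ : ∀ p {c d f m g n} → p (f m) ≡ true → Does c f m g n → Does (condᶜ p c d) f m g n
leftᵈ p eq C rep with C (Rep-touch rep)
... | _ , ρ , rep' = _ , left (tested p rep eq) ρ , rep'

rightᵈ : ∀ p {c d f m g n} → p (f m) ≡ false → Does d f m g n → Does (condᶜ p c d) f m g n
rightᵈ p eq C rep with C (Rep-touch rep)
... | _ , ρ , rep' = _ , right (tested p rep eq) ρ , rep'

-- A left move at the left end stays put without any signal, so the end must carry a mark for this
-- loop to stop.
home : Cmd extra
home = whileᶜ (not ∘ mark) (edit id L)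

home-does : ∀ {f} m → mark (f 0) ≡ true → (∀ j → mark (f (suc j)) ≡ false) → Does home f m f 0
home-does zero    m₀ m₊ = stopᵈ (not ∘ mark) (cong not m₀)
home-does (suc m) m₀ m₊ = loopᵈ (not ∘ mark) (cong not (m₊ m)) (edit-L id (λ _ _ → refl) refl) (home-does m m₀ m₊)

Regs : Set
Regs = Vec ℕ 6

atLeft : ℕ → Bool
atLeft zero    = true
atLeft (suc _) = false

-- Registers are held in unary on their tracks.
tape : (ℕ → Input) → Regs → ℕ → Cell
tape inp ρ j = cell (atLeft j) (mapᵛ (j <ᵇ_) ρ) (inp j)

go-home : ∀ {inp ρ} m → Does home (tape inp ρ) m (tape inp ρ) 0
go-home m = home-does m refl (λ _ → refl)

track : Fin 6 → Cell → Bool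
track i c = lookup (tracks c) i

setTrack : Fin 6 → Bool → Cell → Cell
setTrack i b c = record c { tracks = tracks c [ i ]≔ b }

seek : Fin 6 → Cmd extra
seek i = whileᶜ (track i) (edit id R)

<ᵇ-suc : ∀ m n → (m <ᵇ m + suc n) ≡ true
<ᵇ-suc zero    n = refl
<ᵇ-suc (suc m) n = <ᵇ-suc m n

<ᵇ-irrefl : ∀ n → (n <ᵇ n) ≡ false
<ᵇ-irrefl zero    = refl
<ᵇ-irrefl (suc n) = <ᵇ-irrefl n

<ᵇ-other : ∀ j n → j ≢ n → (j <ᵇ suc n) ≡ (j <ᵇ n)
<ᵇ-other zero    zero    j≢n = ⊥-elim (j≢n refl)
<ᵇ-other zero    (suc n) j≢n = refl
<ᵇ-other (suc j) zero    j≢n = refl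
<ᵇ-other (suc j) (suc n) j≢n = <ᵇ-other j n (j≢n ∘ cong suc)

seek-does : ∀ {inp ρ} i {m} n → lookup ρ i ≡ m + n →
            Does (seek i) (tape inp ρ) m (tape inp ρ) (lookup ρ i)
seek-does {inp} {ρ} i {m} zero eq rewrite +-identityʳ m | eq =
  stopᵈ (track i) (≡-trans (lookup-map i (m <ᵇ_) ρ) (≡-trans (cong (m <ᵇ_) eq) (<ᵇ-irrefl m)))
seek-does {inp} {ρ} i {m} (suc n) eq =
  loopᵈ (track i) (≡-trans (lookup-map i (m <ᵇ_) ρ) (≡-trans (cong (m <ᵇ_) eq) (<ᵇ-suc m n)))
    (edit-R id (λ _ _ → refl) refl) (seek-does i n (≡-trans eq (+-suc m n)))

map-update-other : ∀ {n} j m m' (ρ : Vec ℕ n) i → lookup ρ i ≡ m → (j <ᵇ m') ≡ (j <ᵇ m) →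
                   mapᵛ (j <ᵇ_) (ρ [ i ]≔ m') ≡ mapᵛ (j <ᵇ_) ρ
map-update-other j m m' (x ∷ ρ) zero refl eq = cong (_∷ mapᵛ (j <ᵇ_) ρ) eq
map-update-other j m m' (x ∷ ρ) (suc i) e eq = cong ((j <ᵇ x) ∷_) (map-update-other j m m' ρ i e eq)

map-update : ∀ {n} (f : ℕ → Bool) (ρ : Vec ℕ n) i {m b} → f m ≡ b →
             mapᵛ f (ρ [ i ]≔ m) ≡ (mapᵛ f ρ) [ i ]≔ b
map-update f (x ∷ ρ) zero refl = refl
map-update f (x ∷ ρ) (suc i) eq = cong (f x ∷_) (map-update f ρ i eq)

incᶜ decᶜ : Fin 6 → Cmd extra
incᶜ i = seek i ⨾ edit (setTrack i true) S ⨾ home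
decᶜ i = seek i ⨾ edit id L ⨾ edit (setTrack i false) S ⨾ home

inc-does : ∀ {inp ρ} i →
           Does (incᶜ i) (tape inp ρ) 0 (tape inp (ρ [ i ]≔ suc (lookup ρ i))) 0
inc-does {inp} {ρ} i =
  seek-does i (lookup ρ i) refl ⨾ᵈ
  edit-S (setTrack i true)
    (λ j j≢ → cong (λ ts → cell (atLeft j) ts (inp j))
      (sym (map-update-other j n (suc n) ρ i refl (<ᵇ-other j n j≢))))
    (cong (λ ts → cell (atLeft n) ts (inp n)) (map-update (n <ᵇ_) ρ i n<suc)) ⨾ᵈ
  go-home n
  where
  n = lookup ρ i
  n<suc : (n <ᵇ suc n) ≡ true
  n<suc = subst (λ m → (n <ᵇ m) ≡ true) (+-comm n 1) (<ᵇ-suc n 0)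

dec-does : ∀ {inp ρ} i {n} → lookup ρ i ≡ suc n →
           Does (decᶜ i) (tape inp ρ) 0 (tape inp (ρ [ i ]≔ n)) 0
dec-does {inp} {ρ} i {n} eq =
  subst (Does (seek i) (tape inp ρ) 0 (tape inp ρ)) eq (seek-does i (lookup ρ i) refl) ⨾ᵈ
  edit-L id (λ _ _ → refl) refl ⨾ᵈ
  edit-S (setTrack i false)
    (λ j j≢ → cong (λ ts → cell (atLeft j) ts (inp j))
      (sym (map-update-other j (suc n) n ρ i eq (sym (<ᵇ-other j n j≢)))))
    (cong (λ ts → cell (atLeft n) ts (inp n)) (map-update (n <ᵇ_) ρ i (<ᵇ-irrefl n))) ⨾ᵈ
  go-home n

-- Register programs

-- A test sees which registers are positive.
Test : Set
Test = Vec Bool 6 → Bool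

data Prog : Set where
  inc dec : Fin 6 → Prog
  _⨾_     : Prog → Prog → Prog
  while   : Test → Prog → Prog
  cond    : Test → Prog → Prog → Prog

positive : Regs → Vec Bool 6
positive = mapᵛ (0 <ᵇ_)

data Exec : Prog → Regs → Regs → Set where
  inc   : ∀ {i ρ} → Exec (inc i) ρ (ρ [ i ]≔ suc (lookup ρ i))
  dec   : ∀ {i ρ n} → lookup ρ i ≡ suc n → Exec (dec i) ρ (ρ [ i ]≔ n)
  _⨾_   : ∀ {P Q ρ σ τ} → Exec P ρ σ → Exec Q σ τ → Exec (P ⨾ Q) ρ τ
  stop  : ∀ {p P ρ} → p (positive ρ) ≡ false → Exec (while p P) ρ ρ
  loop  : ∀ {p P ρ σ τ} → p (positive ρ) ≡ true → Exec P ρ σ → Exec (while p P) σ τ →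
          Exec (while p P) ρ τ
  left  : ∀ {p P Q ρ σ} → p (positive ρ) ≡ true → Exec P ρ σ → Exec (cond p P Q) ρ σ
  right : ∀ {p P Q ρ σ} → p (positive ρ) ≡ false → Exec Q ρ σ → Exec (cond p P Q) ρ σ

compile : Prog → Cmd extra
compile (inc i)      = incᶜ i
compile (dec i)      = decᶜ i
compile (P ⨾ Q)      = compile P ⨾ compile Q
compile (while p P)  = whileᶜ (p ∘ tracks) (compile P)
compile (cond p P Q) = condᶜ (p ∘ tracks) (compile P) (compile Q)

compile-does : ∀ {inp P ρ σ} → Exec P ρ σ → Does (compile P) (tape inp ρ) 0 (tape inp σ) 0
compile-does (inc {i})    = inc-does i
compile-does (dec {i} eq) = dec-does i eq
compile-does (E ⨾ F)      = compile-does E ⨾ᵈ compile-does F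
compile-does (stop {p} eq)     = stopᵈ (p ∘ tracks) eq
compile-does (loop {p} eq E F) = loopᵈ (p ∘ tracks) eq (compile-does E) (compile-does F)
compile-does (left {p} eq E)   = leftᵈ (p ∘ tracks) eq (compile-does E)
compile-does (right {p} eq E)  = rightᵈ (p ∘ tracks) eq (compile-does E)

-- Functions on coded lists

-- The bijection (a , b) ↦ 2ᵃ (2 b + 1) between ℕ × ℕ and the positive numbers.
infixr 5 _▹_
_▹_ : ℕ → ℕ → ℕ
zero  ▹ b = suc (b + b)
suc a ▹ b = (a ▹ b) + (a ▹ b)

data View : ℕ → Set where
  nil  : View 0
  cons : ∀ a b → View (a ▹ b)

▹-pos : ∀ a b → ∃ λ n → a ▹ b ≡ suc n
▹-pos zero b = b + b , refl
▹-pos (suc a) b rewrite proj₂ (▹-pos a b) = _ , refl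

double-injective : ∀ {m n} → m + m ≡ n + n → m ≡ n
double-injective {zero} {zero} eq = refl
double-injective {suc m} {suc n} eq =
  cong suc (double-injective (suc-injective (≡-trans (sym (+-suc m m)) (≡-trans (suc-injective eq) (+-suc n n)))))

odd≢even : ∀ m n → suc (m + m) ≢ n + n
odd≢even m (suc n) eq = even≢odd′ n m (suc-injective (≡-trans eq (cong suc (+-suc n n))))
  where
  even≢odd′ : ∀ n m → m + m ≢ suc (n + n)
  even≢odd′ n (suc m) eq = odd≢even m n (≡-trans (sym (+-suc m m)) (suc-injective eq))

▹-injective : ∀ a {b} a' {b'} → a ▹ b ≡ a' ▹ b' → a ≡ a' × b ≡ b'
▹-injective zero zero eq = refl , double-injective (suc-injective eq)
▹-injective zero {b} (suc a') {b'} eq = ⊥-elim (odd≢even b (a' ▹ b') eq)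
▹-injective (suc a) {b} zero {b'} eq = ⊥-elim (odd≢even b' (a ▹ b) (sym eq))
▹-injective (suc a) (suc a') eq with ▹-injective a a' (double-injective eq)
... | refl , refl = refl , refl

data Parity : ℕ → Set where
  even : ∀ m → Parity (m + m)
  odd  : ∀ m → Parity (suc (m + m))

parity : ∀ n → Parity n
parity zero = even 0
parity (suc n) with parity n
... | even m = odd m
... | odd m  = subst Parity (cong suc (+-suc m m)) (even (suc m))

private
  viewBelow : ∀ k n → n ≤ k → View n
  viewBelow k zero _ = nil
  viewBelow (suc k) (suc n) n≤k = split (parity (suc n)) refl
    where
    split : ∀ {m} → Parity m → m ≡ suc n → View m
    split (odd m) _ = cons 0 m
    split (even (suc m)) eq with viewBelow k (suc m) (≤-trans (s≤s (m≤m+n m m))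
      (≤-trans (≤-reflexive (sym (+-suc m m))) (≤-pred (≤-trans (≤-reflexive eq) n≤k))))
    ... | v = double v
      where
      double : ∀ {m} → View (suc m) → View (suc m + suc m)
      double {m} v = halves v refl
        where
        halves : ∀ {j} → View j → j ≡ suc m → View (j + j)
        halves (cons a b) _ = cons (suc a) b

abstract
  view : ∀ n → View n
  view n = viewBelow n n ≤-refl

  private
    hdᵛ tlᵛ : ∀ {n} → View n → ℕ
    hdᵛ nil = 0
    hdᵛ (cons a b) = a
    tlᵛ nil = 0
    tlᵛ (cons a b) = b

    hdᵛ-▹ : ∀ {n} a b (v : View n) → n ≡ a ▹ b → hdᵛ v ≡ a × tlᵛ v ≡ b
    hdᵛ-▹ a b nil eq with ≡-trans eq (proj₂ (▹-pos a b))
    ... | ()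
    hdᵛ-▹ a b (cons a' b') eq = ▹-injective a' a eq

    nilᵛ : ∀ {n} (v : View n) → n ≡ 0 → hdᵛ v ≡ 0 × tlᵛ v ≡ 0
    nilᵛ nil eq = refl , refl
    nilᵛ (cons a b) eq with ≡-trans (sym eq) (proj₂ (▹-pos a b))
    ... | ()

  hd tl : ℕ → ℕ
  hd n = hdᵛ (view n)
  tl n = tlᵛ (view n)

  hd-▹ : ∀ a b → hd (a ▹ b) ≡ a
  hd-▹ a b = proj₁ (hdᵛ-▹ a b (view (a ▹ b)) refl)

  tl-▹ : ∀ a b → tl (a ▹ b) ≡ b
  tl-▹ a b = proj₂ (hdᵛ-▹ a b (view (a ▹ b)) refl)

  hd-0 : hd 0 ≡ 0
  hd-0 = proj₁ (nilᵛ (view 0) refl)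

  tl-0 : tl 0 ≡ 0
  tl-0 = proj₂ (nilᵛ (view 0) refl)

tl<▹ : ∀ a b → b < a ▹ b
tl<▹ zero b = s≤s (m≤m+n b b)
tl<▹ (suc a) b = <-≤-trans (tl<▹ a b) (m≤m+n (a ▹ b) (a ▹ b))

hd<▹ : ∀ a b → a < a ▹ b
hd<▹ zero b = s≤s z≤n
hd<▹ (suc a) b = ≤-trans (≤-reflexive (+-comm 1 (suc a)))
  (+-mono-≤ (hd<▹ a b) (≤-trans (s≤s z≤n) (hd<▹ a b)))

listCode : List ℕ → ℕ
listCode []      = 0
listCode (x ∷ l) = x ▹ listCode l

-- The first argument is fuel. The code itself is enough fuel, since a tail is smaller than the code
-- (`tl<▹`).
elemsBelow : ℕ → ℕ → List ℕ
elemsBelow (suc k) n@(suc _) = hd n ∷ elemsBelow k (tl n)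
elemsBelow _       _         = []

elems : ℕ → List ℕ
elems n = elemsBelow n n

private
  elemsBelow-from : ∀ k l → listCode l ≤ k → elemsBelow k (listCode l) ≡ l
  elemsBelow-from zero [] _ = refl
  elemsBelow-from (suc k) [] _ = refl
  elemsBelow-from zero (x ∷ l) le with subst (_≤ 0) (proj₂ (▹-pos x (listCode l))) le
  ... | ()
  elemsBelow-from (suc k) (x ∷ l) le with x ▹ listCode l in eq | ▹-pos x (listCode l)
  ... | suc n | _ = cong₂ _∷_
    (≡-trans (cong hd (sym eq)) (hd-▹ x _))
    (≡-trans (cong (elemsBelow k) (≡-trans (cong tl (sym eq)) (tl-▹ x _)))
      (elemsBelow-from k l (≤-pred (≤-trans (≤-trans (tl<▹ x (listCode l)) (≤-reflexive eq)) le))))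

  fromBelow : ∀ k n → n ≤ k → listCode (elemsBelow k n) ≡ n
  fromBelow zero zero _ = refl
  fromBelow (suc k) zero _ = refl
  fromBelow (suc k) (suc n) le = split (view (suc n)) refl
    where
    split : ∀ {m} → View m → m ≡ suc n → hd (suc n) ▹ listCode (elemsBelow k (tl (suc n))) ≡ suc n
    split (cons a b) eq = ≡-trans
      (cong₂ (λ h t → h ▹ listCode (elemsBelow k t))
        (≡-trans (cong hd (sym eq)) (hd-▹ a b)) (≡-trans (cong tl (sym eq)) (tl-▹ a b)))
      (≡-trans (cong (a ▹_) (fromBelow k b (≤-pred (≤-trans (tl<▹ a b) (≤-trans (≤-reflexive eq) le))))) eq)

elems-listCode : ∀ l → elems (listCode l) ≡ l
elems-listCode l = elemsBelow-from (listCode l) l ≤-refl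

-- Every number codes a list. Hence `foldᶠ` may run on any register content, and `decode` compiles
-- to nothing.
listCode-elems : ∀ n → listCode (elems n) ≡ n
listCode-elems n = fromBelow n n ≤-refl

infixr 9 _∘ᶠ_
-- Each function takes one number, further arguments being packed with `_▹_`: the head holds the
-- condition of `ifᶠ` and the list of `foldᶠ`, the tail the rest.
data Fun : Set where
  idᶠ zeroᶠ sucᶠ hdᶠ tlᶠ eqᶠ : Fun
  _∘ᶠ_ pairᶠ ifᶠ : Fun → Fun → Fun
  foldᶠ : Fun → Fun

toBit : Bool → ℕ
toBit false = 0
toBit true  = 1

⟦_⟧ : Fun → ℕ → ℕ
⟦ idᶠ ⟧       x = x
⟦ zeroᶠ ⟧     x = 0
⟦ sucᶠ ⟧      x = suc x
⟦ hdᶠ ⟧       x = hd x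
⟦ tlᶠ ⟧       x = tl x
⟦ eqᶠ ⟧       x = toBit (hd x ≡ᵇ tl x)
⟦ F ∘ᶠ G ⟧    x = ⟦ F ⟧ (⟦ G ⟧ x)
⟦ pairᶠ F G ⟧ x = ⟦ F ⟧ x ▹ ⟦ G ⟧ x
⟦ ifᶠ F G ⟧   x = if 0 <ᵇ hd x then ⟦ F ⟧ (tl x) else ⟦ G ⟧ (tl x)
⟦ foldᶠ F ⟧   x = foldl (λ a e → ⟦ F ⟧ (e ▹ a)) (tl x) (elems (hd x))

-- Functions are computed in X, below a stack of saved values coded in Y;
-- between computations the other registers are zero.
pattern X = zero
pattern Y = suc X
pattern Z = suc Y
pattern W = suc Z
pattern V = suc W
pattern U = suc V
pattern ⟨_,_,_,_,_,_⟩ x y z w v u = x ∷ y ∷ z ∷ w ∷ v ∷ u ∷ []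

by : ∀ {P ρ σ τ} → σ ≡ τ → Exec P ρ σ → Exec P ρ τ
by refl E = E

skip : Prog
skip = while (λ _ → false) (inc X)

mv : Fin 6 → Fin 6 → Prog
mv i j = while (λ b → lookup b i) (dec i ⨾ inc j)

clear : Fin 6 → Prog
clear i = while (λ b → lookup b i) (dec i)

lookup-positive : ∀ {n} i (ρ : Vec ℕ n) {m} → lookup ρ i ≡ m →
                  lookup (mapᵛ (0 <ᵇ_) ρ) i ≡ (0 <ᵇ m)
lookup-positive i ρ refl = lookup-map i (0 <ᵇ_) ρ

clear-exec : ∀ {ρ} i → Exec (clear i) ρ (ρ [ i ]≔ 0)
clear-exec {ρ} i = go _ refl
  where
  go : ∀ {ρ} n → lookup ρ i ≡ n → Exec (clear i) ρ (ρ [ i ]≔ 0)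
  go {ρ} zero eq =
    by (≡-trans (sym ([]≔-lookup ρ i)) (cong (ρ [ i ]≔_) eq)) (stop (lookup-positive i ρ eq))
  go {ρ} (suc n) eq =
    by ([]≔-idempotent ρ i)
      (loop (lookup-positive i ρ eq) (dec eq) (go {ρ [ i ]≔ n} n (lookup∘update i ρ n)))

mv-exec : ∀ {ρ} i j → i ≢ j → Exec (mv i j) ρ (ρ [ i ]≔ 0 [ j ]≔ (lookup ρ j + lookup ρ i))
mv-exec {ρ} i j i≢j = go (lookup ρ i) refl
  where
  go : ∀ {ρ} n → lookup ρ i ≡ n → Exec (mv i j) ρ (ρ [ i ]≔ 0 [ j ]≔ (lookup ρ j + n))
  go {ρ} zero eq =
    by (≡-trans (sym ([]≔-lookup ρ j)) (cong₂ (λ σ m → σ [ j ]≔ m)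
         (≡-trans (sym ([]≔-lookup ρ i)) (cong (ρ [ i ]≔_) eq)) (sym (+-identityʳ _))))
       (stop (lookup-positive i ρ eq))
  go {ρ} (suc n) eq =
    by same (loop (lookup-positive i ρ eq) (dec eq ⨾ inc)
      (go n (≡-trans (lookup∘update′ i≢j (ρ [ i ]≔ n) _) (lookup∘update i ρ n))))
    where
    m = lookup ρ j
    σ = ρ [ i ]≔ n
    open ≡-Reasoning
    same : σ [ j ]≔ suc (lookup σ j) [ i ]≔ 0 [ j ]≔ (lookup (σ [ j ]≔ suc (lookup σ j)) j + n) ≡
           ρ [ i ]≔ 0 [ j ]≔ (m + suc n)
    same = begin
      σ [ j ]≔ suc (lookup σ j) [ i ]≔ 0 [ j ]≔ (lookup (σ [ j ]≔ suc (lookup σ j)) j + n)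
        ≡⟨ cong₂ (λ τ p → τ [ j ]≔ (p + n)) ([]≔-commutes σ j i (i≢j ∘ sym)) (lookup∘update j σ _) ⟩
      σ [ i ]≔ 0 [ j ]≔ suc (lookup σ j) [ j ]≔ suc (lookup σ j + n)
        ≡⟨ []≔-idempotent (σ [ i ]≔ 0) j ⟩
      σ [ i ]≔ 0 [ j ]≔ suc (lookup σ j + n)
        ≡⟨ cong₂ (λ τ p → τ [ j ]≔ p) ([]≔-idempotent ρ i)
             (≡-trans (cong (λ p → suc (p + n)) (lookup∘update′ (i≢j ∘ sym) ρ n)) (sym (+-suc m n))) ⟩
      ρ [ i ]≔ 0 [ j ]≔ (m + suc n) ∎

cong-at : ∀ {P ρ} {n m : ℕ} (f : ℕ → Regs) → n ≡ m → Exec P ρ (f n) → Exec P ρ (f m)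
cong-at f refl E = E

-- `Y` holds a list code and `Z` its head. Consing forms 2b + 1 and doubles it `Z` times; unconsing
-- halves until the remainder in `V` is 1 and counts in `Z`. The code 0 is left alone, because
-- repeated halving would never meet an odd number.
dblY consP halve unconsP : Prog
dblY = while (λ b → lookup b Y) (dec Y ⨾ inc W ⨾ inc W) ⨾ mv W Y
consP = dblY ⨾ inc Y ⨾ while (λ b → lookup b Z) (dec Z ⨾ dblY)
halve = while (λ b → lookup b Y)
  (dec Y ⨾ cond (λ b → lookup b Y) (dec Y ⨾ inc W) (inc V))
unconsP = cond (λ b → lookup b Y)
  (halve ⨾ while (λ b → not (lookup b V)) (inc Z ⨾ mv W Y ⨾ halve) ⨾ dec V ⨾ mv W Y) skip

dblY-exec : ∀ {x y z v u} → Exec dblY ⟨ x , y , z , 0 , v , u ⟩ ⟨ x , y + y , z , 0 , v , u ⟩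
dblY-exec {x} {y} {z} {v} {u} = go y 0 ⨾ mv-exec W Y (λ ())
  where
  go : ∀ y w → Exec (while (λ b → lookup b Y) (dec Y ⨾ inc W ⨾ inc W))
         ⟨ x , y , z , w , v , u ⟩ ⟨ x , 0 , z , w + (y + y) , v , u ⟩
  go zero w = cong-at (λ w → ⟨ x , 0 , z , w , v , u ⟩) (sym (+-identityʳ w)) (stop refl)
  go (suc y) w = cong-at (λ w → ⟨ x , 0 , z , w , v , u ⟩)
    (sym (≡-trans (+-suc w (y + suc y)) (cong suc (≡-trans (cong (w +_) (+-suc y y)) (+-suc w (y + y))))))
    (loop refl (dec refl ⨾ inc ⨾ inc) (go y (suc (suc w))))

consP-exec : ∀ {x a b v u} → Exec consP ⟨ x , b , a , 0 , v , u ⟩ ⟨ x , a ▹ b , 0 , 0 , v , u ⟩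
consP-exec {x} {a} {b} {v} {u} = dblY-exec ⨾ inc ⨾ go a 0
  where
  go : ∀ a c → Exec (while (λ b → lookup b Z) (dec Z ⨾ dblY))
         ⟨ x , c ▹ b , a , 0 , v , u ⟩ ⟨ x , (c + a) ▹ b , 0 , 0 , v , u ⟩
  go zero c = cong-at (λ c → ⟨ x , c ▹ b , 0 , 0 , v , u ⟩) (sym (+-identityʳ c)) (stop refl)
  go (suc a) c = cong-at (λ c → ⟨ x , c ▹ b , 0 , 0 , v , u ⟩) (sym (+-suc c a))
    (loop refl (dec refl ⨾ dblY-exec) (go a (suc c)))

halve-even : ∀ {x z v u} m w → Exec halve ⟨ x , m + m , z , w , v , u ⟩ ⟨ x , 0 , z , w + m , v , u ⟩
halve-even {x} {z} {v} {u} zero w =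
  cong-at (λ w → ⟨ x , 0 , z , w , v , u ⟩) (sym (+-identityʳ w)) (stop refl)
halve-even {x} {z} {v} {u} (suc m) w rewrite +-suc m m =
  cong-at (λ w → ⟨ x , 0 , z , w , v , u ⟩) (sym (+-suc w m))
    (loop refl (dec refl ⨾ left refl (dec refl ⨾ inc)) (halve-even m (suc w)))

halve-odd : ∀ {x z u} m w → Exec halve ⟨ x , suc (m + m) , z , w , 0 , u ⟩ ⟨ x , 0 , z , w + m , 1 , u ⟩
halve-odd {x} {z} {u} zero w =
  cong-at (λ w → ⟨ x , 0 , z , w , 1 , u ⟩) (sym (+-identityʳ w))
    (loop refl (dec refl ⨾ right refl inc) (stop refl))
halve-odd {x} {z} {u} (suc m) w rewrite +-suc m m =
  cong-at (λ w → ⟨ x , 0 , z , w , 1 , u ⟩) (sym (+-suc w m))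
    (loop refl (dec refl ⨾ left refl (dec refl ⨾ inc)) (halve-odd m (suc w)))

▹-positive : ∀ a b → (0 <ᵇ a ▹ b) ≡ true
▹-positive a b rewrite proj₂ (▹-pos a b) = refl

unconsP-exec : ∀ {x a b u} → Exec unconsP ⟨ x , a ▹ b , 0 , 0 , 0 , u ⟩ ⟨ x , b , a , 0 , 0 , u ⟩
unconsP-exec {x} {a} {b} {u} with go a 0
  where
  go : ∀ a z → ∃ λ σ → Exec halve ⟨ x , a ▹ b , z , 0 , 0 , u ⟩ σ ×
       Exec (while (λ b → not (lookup b V)) (inc Z ⨾ mv W Y ⨾ halve)) σ ⟨ x , 0 , z + a , b , 1 , u ⟩
  go zero z = _ , halve-odd b 0 , cong-at (λ z → ⟨ x , 0 , z , b , 1 , u ⟩) (sym (+-identityʳ z)) (stop refl)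
  go (suc a) z with go a (suc z)
  ... | σ , E , F = _ , halve-even (a ▹ b) 0 ,
    cong-at (λ z → ⟨ x , 0 , z , b , 1 , u ⟩) (sym (+-suc z a))
      (loop refl (inc ⨾ mv-exec W Y (λ ()) ⨾ E) F)
... | σ , E , F = left (▹-positive a b) (E ⨾ F ⨾ dec refl ⨾ mv-exec W Y (λ ()))

unconsP-exec-0 : ∀ {x u} → Exec unconsP ⟨ x , 0 , 0 , 0 , 0 , u ⟩ ⟨ x , 0 , 0 , 0 , 0 , u ⟩
unconsP-exec-0 = right refl (stop refl)

-- The last three serve `pairᶠ F G`: `push` saves the argument, `popSwap` exchanges it for the
-- result of `F`, and `consTop` joins that result with the one of `G`.
swapXY swapXZ split push popSwap consTop : Prog
swapXY  = mv X W ⨾ mv Y X ⨾ mv W Y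
swapXZ  = mv X W ⨾ mv Z X ⨾ mv W Z
split   = swapXY ⨾ unconsP
push    = while (λ b → lookup b X) (dec X ⨾ inc Z ⨾ inc W) ⨾ mv W X ⨾ consP
popSwap = unconsP ⨾ swapXZ ⨾ consP
consTop = unconsP ⨾ swapXY ⨾ consP ⨾ swapXY

swapXY-exec : ∀ {x y z v u} → Exec swapXY ⟨ x , y , z , 0 , v , u ⟩ ⟨ y , x , z , 0 , v , u ⟩
swapXY-exec = mv-exec X W (λ ()) ⨾ mv-exec Y X (λ ()) ⨾ mv-exec W Y (λ ())

swapXZ-exec : ∀ {x y z v u} → Exec swapXZ ⟨ x , y , z , 0 , v , u ⟩ ⟨ z , y , x , 0 , v , u ⟩
swapXZ-exec = mv-exec X W (λ ()) ⨾ mv-exec Z X (λ ()) ⨾ mv-exec W Z (λ ())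

split-exec : ∀ {x s} → Exec split ⟨ x , s , 0 , 0 , 0 , 0 ⟩ ⟨ s , tl x , hd x , 0 , 0 , 0 ⟩
split-exec {x} {s} with view x
... | nil rewrite hd-0 | tl-0 = swapXY-exec ⨾ unconsP-exec-0
... | cons a b rewrite hd-▹ a b | tl-▹ a b = swapXY-exec ⨾ unconsP-exec

push-exec : ∀ {x s} → Exec push ⟨ x , s , 0 , 0 , 0 , 0 ⟩ ⟨ x , x ▹ s , 0 , 0 , 0 , 0 ⟩
push-exec {x} {s} = go x 0 ⨾ mv-exec W X (λ ()) ⨾ consP-exec
  where
  go : ∀ x z → Exec (while (λ b → lookup b X) (dec X ⨾ inc Z ⨾ inc W))
         ⟨ x , s , z , z , 0 , 0 ⟩ ⟨ 0 , s , z + x , z + x , 0 , 0 ⟩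
  go zero z = cong-at (λ z → ⟨ 0 , s , z , z , 0 , 0 ⟩) (sym (+-identityʳ z)) (stop refl)
  go (suc x) z = cong-at (λ z → ⟨ 0 , s , z , z , 0 , 0 ⟩) (sym (+-suc z x))
    (loop refl (dec refl ⨾ inc ⨾ inc) (go x (suc z)))

program : Fun → Prog
program idᶠ         = skip
program zeroᶠ       = clear X
program sucᶠ        = inc X
program hdᶠ         = split ⨾ clear Y ⨾ mv X Y ⨾ mv Z X
program tlᶠ         = split ⨾ clear Z ⨾ swapXY
program eqᶠ         = split ⨾ while (λ b → lookup b Z ∧ lookup b Y) (dec Z ⨾ dec Y) ⨾
  cond (λ b → lookup b Z ∨ lookup b Y) (clear Z ⨾ clear Y ⨾ mv X Y) (mv X Y ⨾ inc X)
program (F ∘ᶠ G)    = program G ⨾ program F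
program (pairᶠ F G) = push ⨾ program F ⨾ popSwap ⨾ program G ⨾ consTop
program (ifᶠ F G)   = split ⨾ swapXY ⨾
  cond (λ b → lookup b Z) (clear Z ⨾ program F) (program G)
-- `Z` carries the unread list. Before `F` runs, `U` shelters the stack while element and
-- accumulator are packed into `X`; the rest of the list then waits on the stack until `F` is done.
program (foldᶠ F)   = split ⨾ swapXY ⨾ while (λ b → lookup b Z)
  (mv Y U ⨾ mv Z Y ⨾ unconsP ⨾ swapXY ⨾ consP ⨾
   mv X Z ⨾ mv Y X ⨾ mv U Y ⨾ consP ⨾ program F ⨾ unconsP)

program-exec : ∀ F {x s} →
  Exec (program F) ⟨ x , s , 0 , 0 , 0 , 0 ⟩ ⟨ ⟦ F ⟧ x , s , 0 , 0 , 0 , 0 ⟩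
program-exec idᶠ = stop refl
program-exec zeroᶠ = clear-exec X
program-exec sucᶠ = inc
program-exec hdᶠ = split-exec ⨾ clear-exec Y ⨾ mv-exec X Y (λ ()) ⨾ mv-exec Z X (λ ())
program-exec tlᶠ = split-exec ⨾ clear-exec Z ⨾ swapXY-exec
program-exec eqᶠ {x} {s} with go (hd x) (tl x)
  where
  go : ∀ z y → ∃ λ σ →
    Exec (while (λ b → lookup b Z ∧ lookup b Y) (dec Z ⨾ dec Y)) ⟨ s , y , z , 0 , 0 , 0 ⟩ σ ×
    Exec (cond (λ b → lookup b Z ∨ lookup b Y) (clear Z ⨾ clear Y ⨾ mv X Y) (mv X Y ⨾ inc X)) σ
      ⟨ toBit (z ≡ᵇ y) , s , 0 , 0 , 0 , 0 ⟩
  go zero zero = _ , stop refl , right refl (mv-exec X Y (λ ()) ⨾ inc)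
  go zero (suc y) = _ , stop refl , left refl (clear-exec Z ⨾ clear-exec Y ⨾ mv-exec X Y (λ ()))
  go (suc z) zero = _ , stop refl , left refl (clear-exec Z ⨾ clear-exec Y ⨾ mv-exec X Y (λ ()))
  go (suc z) (suc y) with go z y
  ... | σ , E , F = σ , loop refl (dec refl ⨾ dec refl) E , F
... | σ , E , F = split-exec ⨾ E ⨾ F
program-exec (F ∘ᶠ G) = program-exec G ⨾ program-exec F
program-exec (pairᶠ F G) {x} {s} =
  push-exec ⨾ program-exec F ⨾ (unconsP-exec {a = x} {s} ⨾ swapXZ-exec ⨾ consP-exec) ⨾
  program-exec G ⨾ (unconsP-exec {a = ⟦ F ⟧ x} {s} ⨾ swapXY-exec ⨾ consP-exec ⨾ swapXY-exec)
program-exec (ifᶠ F G) {x} {s} = split-exec ⨾ swapXY-exec ⨾ branch (hd x)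
  where
  branch : ∀ c → Exec (cond (λ b → lookup b Z) (clear Z ⨾ program F) (program G))
    ⟨ tl x , s , c , 0 , 0 , 0 ⟩
    ⟨ (if 0 <ᵇ c then ⟦ F ⟧ (tl x) else ⟦ G ⟧ (tl x)) , s , 0 , 0 , 0 , 0 ⟩
  branch zero = right refl (program-exec G)
  branch (suc c) = left refl (clear-exec Z ⨾ program-exec F)
program-exec (foldᶠ F) {x} {s} =
  split-exec ⨾ swapXY-exec ⨾ subst (λ n → Exec _ ⟨ tl x , s , n , 0 , 0 , 0 ⟩
      ⟨ ⟦ foldᶠ F ⟧ x , s , 0 , 0 , 0 , 0 ⟩)
    (listCode-elems (hd x)) (go (elems (hd x)) (tl x))
  where
  go : ∀ l a → Exec (while (λ b → lookup b Z)
      (mv Y U ⨾ mv Z Y ⨾ unconsP ⨾ swapXY ⨾ consP ⨾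
       mv X Z ⨾ mv Y X ⨾ mv U Y ⨾ consP ⨾ program F ⨾ unconsP))
    ⟨ a , s , listCode l , 0 , 0 , 0 ⟩ ⟨ foldl (λ a e → ⟦ F ⟧ (e ▹ a)) a l , s , 0 , 0 , 0 , 0 ⟩
  go [] a = stop refl
  go (e ∷ l) a = loop (▹-positive e (listCode l))
    (mv-exec Y U (λ ()) ⨾ mv-exec Z Y (λ ()) ⨾ unconsP-exec {a = e} {listCode l} ⨾ swapXY-exec ⨾ consP-exec ⨾
     mv-exec X Z (λ ()) ⨾ mv-exec Y X (λ ()) ⨾ mv-exec U Y (λ ()) ⨾ consP-exec ⨾
     program-exec F ⨾ unconsP-exec {a = listCode l} {s})
    (go l (⟦ F ⟧ (e ▹ a)))

-- Loading the input word into a register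

open Cell

-- The input track after the first p bits have been read, x being the rest.
inputs : ℕ → Str → ℕ → Input
inputs (suc p) x       zero    = inputRead
inputs (suc p) x       (suc j) = inputs p x j
inputs zero    []      j       = noInput
inputs zero    (b ∷ x) zero    = inputBit b
inputs zero    (b ∷ x) (suc j) = inputs zero x j

inputs-at : ∀ p x → inputs p x p ≡ inputs 0 x 0
inputs-at zero x = refl
inputs-at (suc p) x = inputs-at p x

inputs-below : ∀ m n x → inputs (m + suc n) x m ≡ inputRead
inputs-below zero n x = refl
inputs-below (suc m) n x = inputs-below m n x

inputs-other : ∀ p b x j → j ≢ p → inputs p (b ∷ x) j ≡ inputs (suc p) x j
inputs-other zero b x zero j≢p = ⊥-elim (j≢p refl)
inputs-other zero b x (suc j) j≢p = refl
inputs-other (suc p) b x zero j≢p = refl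
inputs-other (suc p) b x (suc j) j≢p = inputs-other p b x j (j≢p ∘ cong suc)

isRead isBit isOne : Cell → Bool
isRead c = proj₁ (input c) ∧ proj₂ (input c)
isBit c  = proj₁ (input c) xor proj₂ (input c)
isOne c  = proj₂ (input c)

skipRead : Cmd extra
skipRead = whileᶜ isRead (edit id R)

skipRead-does : ∀ {p x ρ} → Does skipRead (tape (inputs p x) ρ) 0 (tape (inputs p x) ρ) p
skipRead-does {p} {x} {ρ} = go 0 p refl
  where
  start-unread : ∀ x → proj₁ (inputs 0 x 0) ∧ proj₂ (inputs 0 x 0) ≡ false
  start-unread []          = refl
  start-unread (false ∷ x) = refl
  start-unread (true ∷ x)  = refl
  go : ∀ m n → m + n ≡ p → Does skipRead (tape (inputs p x) ρ) m (tape (inputs p x) ρ) p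
  go m zero eq rewrite +-identityʳ m | eq = stopᵈ isRead
    (≡-trans (cong (λ i → proj₁ i ∧ proj₂ i) (inputs-at p x)) (start-unread x))
  go m (suc n) refl = loopᵈ isRead (cong (λ i → proj₁ i ∧ proj₂ i) (inputs-below m n x))
    (edit-R id (λ _ _ → refl) refl) (go (suc m) n (sym (+-suc m n)))

pushBit : Bool → Prog
pushBit false = mv X Y ⨾ consP ⨾ mv Y X
pushBit true  = mv X Y ⨾ inc Z ⨾ consP ⨾ mv Y X

pattern ⟨_⟩ x = ⟨ x , 0 , 0 , 0 , 0 , 0 ⟩

pushBit-exec : ∀ b {x} → Exec (pushBit b) ⟨ x ⟩ ⟨ toBit b ▹ x ⟩
pushBit-exec false = mv-exec X Y (λ ()) ⨾ consP-exec ⨾ mv-exec Y X (λ ())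
pushBit-exec true  = mv-exec X Y (λ ()) ⨾ inc ⨾ consP-exec ⨾ mv-exec Y X (λ ())

setRead setMark : Cell → Cell
setRead c = record c { input = inputRead }
setMark c = record c { mark = true }

readBit : Bool → Cmd extra
readBit b = edit setRead S ⨾ home ⨾ compile (pushBit b)

-- Each bit is marked as read and pushed onto the list in `X`, which takes the head home. Passing
-- over the marks finds the next unread bit again.
load : Cmd extra
load = edit setMark S ⨾ skipRead ⨾
  whileᶜ isBit (condᶜ isOne (readBit true) (readBit false) ⨾ skipRead) ⨾ home

readBit-does : ∀ {p b x n} →
  Does (readBit b) (tape (inputs p (b ∷ x)) ⟨ n ⟩) p (tape (inputs (suc p) x) ⟨ toBit b ▹ n ⟩) 0
readBit-does {p} {b} {x} {n} =
  edit-S setRead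
    (λ j j≢p → cong (cell (atLeft j) (mapᵛ (j <ᵇ_) ⟨ n ⟩)) (inputs-other p b x j j≢p))
    (cong (cell (atLeft p) (mapᵛ (p <ᵇ_) ⟨ n ⟩)) (≡-trans (cong (λ q → inputs q x p) (+-comm 1 p)) (inputs-below p 0 x))) ⨾ᵈ
  go-home {inputs (suc p) x} {⟨ n ⟩} p ⨾ᵈ compile-does (pushBit-exec b)

readAll-does : ∀ x {p n} →
  Does (whileᶜ isBit (condᶜ isOne (readBit true) (readBit false) ⨾ skipRead) ⨾ home)
    (tape (inputs p x) ⟨ n ⟩) p
    (tape (inputs (foldl (λ p _ → suc p) p x) []) ⟨ foldl (λ n b → toBit b ▹ n) n x ⟩) 0
readAll-does x {p} {n} = go x ⨾ᵈ
  go-home {inputs (foldl (λ p _ → suc p) p x) []} {⟨ foldl (λ n b → toBit b ▹ n) n x ⟩}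
    (foldl (λ p _ → suc p) p x)
  where
  bit-here : ∀ {p b x} (f : Input → Bool) → f (inputs p (b ∷ x) p) ≡ f (inputBit b)
  bit-here {p} {b} {x} f = cong f (inputs-at p (b ∷ x))
  go : ∀ x {p n} → Does (whileᶜ isBit (condᶜ isOne (readBit true) (readBit false) ⨾ skipRead))
    (tape (inputs p x) ⟨ n ⟩) p
    (tape (inputs (foldl (λ p _ → suc p) p x) []) ⟨ foldl (λ n b → toBit b ▹ n) n x ⟩)
    (foldl (λ p _ → suc p) p x)
  go [] {p} = stopᵈ isBit (cong (λ i → proj₁ i xor proj₂ i) (inputs-at p []))
  go (false ∷ x) {p} {n} = loopᵈ isBit (bit-here {p} (λ i → proj₁ i xor proj₂ i))
    (rightᵈ isOne (bit-here {p} proj₂) (readBit-does {p} {false} {x} {n}) ⨾ᵈ skipRead-does {suc p} {x} {⟨ toBit false ▹ n ⟩}) (go x)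
  go (true ∷ x) {p} {n} = loopᵈ isBit (bit-here {p} (λ i → proj₁ i xor proj₂ i))
    (leftᵈ isOne (bit-here {p} proj₂) (readBit-does {p} {true} {x} {n}) ⨾ᵈ skipRead-does {suc p} {x} {⟨ toBit true ▹ n ⟩}) (go x)

initial-Rep : ∀ x → Rep (λ j → cell false (replicateᵛ 6 false) (inputs 0 x j)) 0 ([] , map enc x)
initial-Rep x = mkRep _ (go x)
  where
  go : ∀ x j → read (at (map enc x) j) ≡ cell false (replicateᵛ 6 false) (inputs 0 x j)
  go []      j       = read-blank
  go (b ∷ x) zero    = read-enc b
  go (b ∷ x) (suc j) = go x j

load-does : ∀ x → Does load (λ j → cell false (replicateᵛ 6 false) (inputs 0 x j)) 0
  (tape (inputs (foldl (λ p _ → suc p) 0 x) []) ⟨ foldl (λ n b → toBit b ▹ n) 0 x ⟩) 0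
load-does x =
  edit-S setMark (λ { zero j≢ → ⊥-elim (j≢ refl) ; (suc j) _ → refl }) refl ⨾ᵈ
  skipRead-does {0} {x} {⟨ 0 ⟩} ⨾ᵈ readAll-does x {0} {0}

-- Bits are pushed as they are read, so the last one ends up at the head. `Tm⇒Recursive` undoes this
-- reversal with `reverseᶠ`.
loaded : ∀ x → foldl (λ n b → toBit b ▹ n) 0 x ≡ listCode (map toBit (reverse x))
loaded x = go x []
  where
  go : ∀ x y → foldl (λ n b → toBit b ▹ n) (listCode (map toBit y)) x ≡ listCode (map toBit (x ʳ++ y))
  go []      y = refl
  go (b ∷ x) y = go x (b ∷ y)

decider-recursive : ∀ {k} (c : Cmd k) (p : Sym k → Bool) (f : Str → Bool) →
  (∀ x → ∃ λ t → Run c ([] , map enc x) t × p (scan t) ≡ f x) → Recursive (λ x → f x ≡ true)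
decider-recursive c p f run = decider c p , decider-deterministic c p , decide
  where
  out : ∀ x → Out (decider c p) ∅ x (verdict (f x))
  out x with run x
  ... | t , ρ , eq = subst (λ b → Out (decider c p) ∅ x (verdict b)) eq (decider-out c p ∅ x ρ)
  decide : ∀ x → (f x ≡ true × Out (decider c p) ∅ x acc) ⊎
                 ((f x ≡ true → ⊥) × Out (decider c p) ∅ x rej)
  decide x with f x | out x
  ... | true  | o = inj₁ (refl , o)
  ... | false | o = inj₂ ((λ ()) , o)

recursive : ∀ F (f : Str → Bool) →
            (∀ x → ⟦ F ⟧ (listCode (map toBit (reverse x))) ≡ toBit (f x)) →
            Recursive (λ x → f x ≡ true)
recursive F f F≗f = decider-recursive (load ⨾ compile (program F)) (track X ∘ read) f run
  where
  sign : ∀ b → (0 <ᵇ toBit b) ≡ b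
  sign false = refl
  sign true  = refl
  run : ∀ x → ∃ λ t → Run (load ⨾ compile (program F)) ([] , map enc x) t × track X (read (scan t)) ≡ f x
  run x with (load-does x ⨾ᵈ compile-does (program-exec F {foldl (λ n b → toBit b ▹ n) 0 x} {0})) (initial-Rep x)
  ... | t , ρ , rep = t , ρ , ≡-trans (cong (track X) (scan-Rep rep)) (≡-trans
    (cong (0 <ᵇ_) (≡-trans (cong ⟦ F ⟧ (loaded x)) (F≗f x))) (sign (f x)))

-- Typed programs

infixr 6 _⊗_
data Ty : Set where
  nat bool : Ty
  _⊗_      : Ty → Ty → Ty
  list     : Ty → Ty

El : Ty → Set
El nat      = ℕ
El bool     = Bool
El (σ ⊗ τ)  = El σ × El τ
El (list τ) = List (El τ)

code : ∀ τ → El τ → ℕ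
code nat      n       = n
code bool     b       = toBit b
code (σ ⊗ τ)  (a , b) = code σ a ▹ code τ b
code (list τ) l       = listCode (map (code τ) l)

listCode-injective : ∀ {l l'} → listCode l ≡ listCode l' → l ≡ l'
listCode-injective {l} {l'} eq =
  ≡-trans (sym (elems-listCode l)) (≡-trans (cong elems eq) (elems-listCode l'))

-- This justifies testing equality on codes at every type, as `test` does.
code-injective : ∀ τ {a b} → code τ a ≡ code τ b → a ≡ b
code-injective nat eq = eq
code-injective bool {false} {false} eq = refl
code-injective bool {true} {true} eq = refl
code-injective (σ ⊗ τ) {a , b} {a' , b'} eq with ▹-injective (code σ a) (code σ a') eq
... | eqσ , eqτ = cong₂ _,_ (code-injective σ eqσ) (code-injective τ eqτ)
code-injective (list τ) eq = map-injective (code-injective τ) (listCode-injective eq)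

caseList : ∀ {A B : Set} → B → (A → List A → B) → List A → B
caseList z s []      = z
caseList z s (a ∷ l) = s a l

-- Γ is the type of the environment.
data Tm (Γ : Ty) : Ty → Set
⟪_⟫ : ∀ {Γ τ} → Tm Γ τ → El Γ → El τ

infixl 9 _·_
data Tm Γ where
  var    : Tm Γ Γ
  _·_    : ∀ {σ τ} → Tm σ τ → Tm Γ σ → Tm Γ τ
  const  : ∀ {τ} → El τ → Tm Γ τ
  pair   : ∀ {σ τ} → Tm Γ σ → Tm Γ τ → Tm Γ (σ ⊗ τ)
  fst    : ∀ {σ τ} → Tm Γ (σ ⊗ τ) → Tm Γ σ
  snd    : ∀ {σ τ} → Tm Γ (σ ⊗ τ) → Tm Γ τ
  ite    : ∀ {τ} → Tm Γ bool → Tm Γ τ → Tm Γ τ → Tm Γ τ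
  test   : ∀ {τ} → Tm Γ τ → Tm Γ τ → Tm Γ bool
  cons   : ∀ {τ} → Tm Γ τ → Tm Γ (list τ) → Tm Γ (list τ)
  case   : ∀ {σ τ} → Tm Γ (list σ) → Tm Γ τ → Tm (Γ ⊗ σ ⊗ list σ) τ → Tm Γ τ
  fold   : ∀ {σ τ} → Tm (Γ ⊗ σ ⊗ τ) τ → Tm Γ τ → Tm Γ (list σ) → Tm Γ τ
  -- Untyped access to codes: machine tables and stage indices are plain numbers, and not every
  -- number is the table of a machine.
  headᵗ tailᵗ next : Tm Γ nat → Tm Γ nat
  decode : Tm Γ nat → Tm Γ (list nat)
  encode : Tm Γ (nat ⊗ nat) → Tm Γ nat
  -- The meaning becomes the given `f`, while compilation still uses `t`. Derived programs thus
  -- evaluate to the ordinary list functions.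
  as     : ∀ {τ} (f : El Γ → El τ) (t : Tm Γ τ) → (∀ e → ⟪ t ⟫ e ≡ f e) → Tm Γ τ

⟪ var ⟫ e        = e
⟪ t · u ⟫ e      = ⟪ t ⟫ (⟪ u ⟫ e)
⟪ const a ⟫ e    = a
⟪ pair t u ⟫ e   = ⟪ t ⟫ e , ⟪ u ⟫ e
⟪ fst t ⟫ e      = proj₁ (⟪ t ⟫ e)
⟪ snd t ⟫ e      = proj₂ (⟪ t ⟫ e)
⟪ ite c t u ⟫ e  = if ⟪ c ⟫ e then ⟪ t ⟫ e else ⟪ u ⟫ e
⟪ test {τ} t u ⟫ e = code τ (⟪ t ⟫ e) ≡ᵇ code τ (⟪ u ⟫ e)
⟪ cons t u ⟫ e   = ⟪ t ⟫ e ∷ ⟪ u ⟫ e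
⟪ case l z s ⟫ e = caseList (⟪ z ⟫ e) (λ a l' → ⟪ s ⟫ (e , a , l')) (⟪ l ⟫ e)
⟪ fold h z l ⟫ e = foldr (λ a b → ⟪ h ⟫ (e , a , b)) (⟪ z ⟫ e) (⟪ l ⟫ e)
⟪ headᵗ t ⟫ e    = hd (⟪ t ⟫ e)
⟪ tailᵗ t ⟫ e    = tl (⟪ t ⟫ e)
⟪ next t ⟫ e     = suc (⟪ t ⟫ e)
⟪ decode t ⟫ e   = elems (⟪ t ⟫ e)
⟪ encode t ⟫ e   = proj₁ (⟪ t ⟫ e) ▹ proj₂ (⟪ t ⟫ e)
⟪ as f t _ ⟫ e   = f e

constantᶠ : ℕ → Fun
constantᶠ zero    = zeroᶠ
constantᶠ (suc n) = sucᶠ ∘ᶠ constantᶠ n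

reverseᶠ : Fun
reverseᶠ = foldᶠ idᶠ ∘ᶠ pairᶠ idᶠ zeroᶠ

-- The environment travels along with the accumulator.
foldStep : Fun → Fun
foldStep H = pairᶠ (hdᶠ ∘ᶠ tlᶠ) (H ∘ᶠ pairᶠ (hdᶠ ∘ᶠ tlᶠ) (pairᶠ hdᶠ (tlᶠ ∘ᶠ tlᶠ)))

fun : ∀ {Γ τ} → Tm Γ τ → Fun
fun var                = idᶠ
fun (t · u)            = fun t ∘ᶠ fun u
fun (const {τ} a)      = constantᶠ (code τ a)
fun (pair t u)         = pairᶠ (fun t) (fun u)
fun (fst t)            = hdᶠ ∘ᶠ fun t
fun (snd t)            = tlᶠ ∘ᶠ fun t
fun (ite c t u)        = ifᶠ (fun t) (fun u) ∘ᶠ pairᶠ (fun c) idᶠ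
fun (test t u)          = eqᶠ ∘ᶠ pairᶠ (fun t) (fun u)
fun (cons t u)         = pairᶠ (fun t) (fun u)
fun (case l z s)       = ifᶠ (fun s ∘ᶠ pairᶠ idᶠ (fun l)) (fun z) ∘ᶠ pairᶠ (fun l) idᶠ
-- `foldᶠ` works from the left and `fold` from the right, hence the reversal.
fun (fold h z l)       =
  tlᶠ ∘ᶠ foldᶠ (foldStep (fun h)) ∘ᶠ pairᶠ (reverseᶠ ∘ᶠ fun l) (pairᶠ idᶠ (fun z))
fun (headᵗ t)          = hdᶠ ∘ᶠ fun t
fun (tailᵗ t)          = tlᶠ ∘ᶠ fun t
fun (next t)           = sucᶠ ∘ᶠ fun t
fun (decode t)         = fun t
fun (encode t)         = fun t
fun (as f t _)         = fun t

constantᶠ-correct : ∀ n x → ⟦ constantᶠ n ⟧ x ≡ n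
constantᶠ-correct zero    x = refl
constantᶠ-correct (suc n) x = cong suc (constantᶠ-correct n x)

reverseᶠ-correct : ∀ {τ} l → ⟦ reverseᶠ ⟧ (code (list τ) l) ≡ code (list τ) (reverse l)
reverseᶠ-correct {τ} l rewrite hd-▹ (code (list τ) l) 0 | tl-▹ (code (list τ) l) 0
                             | elems-listCode (map (code τ) l) = go l []
  where
  go : ∀ l l' → foldl (λ a e → e ▹ a) (code (list τ) l') (map (code τ) l) ≡
                code (list τ) (foldl (flip _∷_) l' l)
  go []      l' = refl
  go (a ∷ l) l' = go l (a ∷ l')

foldStep-correct : ∀ H n a b → ⟦ foldStep H ⟧ (a ▹ n ▹ b) ≡ n ▹ ⟦ H ⟧ (n ▹ a ▹ b)
foldStep-correct H n a b
  rewrite hd-▹ a (n ▹ b) | tl-▹ a (n ▹ b) | hd-▹ n b | tl-▹ n b = refl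

fun-correct : ∀ {Γ τ} (t : Tm Γ τ) e → ⟦ fun t ⟧ (code Γ e) ≡ code τ (⟪ t ⟫ e)
fun-correct var e = refl
fun-correct (t · u) e = ≡-trans (cong ⟦ fun t ⟧ (fun-correct u e)) (fun-correct t (⟪ u ⟫ e))
fun-correct {Γ} (const {τ} a) e = constantᶠ-correct (code τ a) (code Γ e)
fun-correct (pair t u) e = cong₂ _▹_ (fun-correct t e) (fun-correct u e)
fun-correct (fst {σ} {τ} t) e =
  ≡-trans (cong hd (fun-correct t e)) (hd-▹ (code σ (proj₁ (⟪ t ⟫ e))) _)
fun-correct (snd {σ} {τ} t) e =
  ≡-trans (cong tl (fun-correct t e)) (tl-▹ (code σ (proj₁ (⟪ t ⟫ e))) _)
fun-correct {Γ} (ite c t u) e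
  rewrite hd-▹ (⟦ fun c ⟧ (code Γ e)) (code Γ e) | tl-▹ (⟦ fun c ⟧ (code Γ e)) (code Γ e)
        | fun-correct c e with ⟪ c ⟫ e
... | true  = fun-correct t e
... | false = fun-correct u e
fun-correct {Γ} (test t u) e = cong₂ (λ m n → toBit (m ≡ᵇ n))
  (≡-trans (hd-▹ (⟦ fun t ⟧ (code Γ e)) _) (fun-correct t e))
  (≡-trans (tl-▹ (⟦ fun t ⟧ (code Γ e)) _) (fun-correct u e))
fun-correct (cons t u) e = cong₂ _▹_ (fun-correct t e) (fun-correct u e)
fun-correct {Γ} (case {σ} l z s) e
  rewrite hd-▹ (⟦ fun l ⟧ (code Γ e)) (code Γ e) | tl-▹ (⟦ fun l ⟧ (code Γ e)) (code Γ e)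
        | fun-correct l e with ⟪ l ⟫ e
... | [] = fun-correct z e
... | a ∷ l' rewrite ▹-positive (code σ a) (code (list σ) l') = fun-correct s (e , a , l')
fun-correct {Γ} (fold {σ} {τ} h z l) e = ≡-trans
  (cong₂ (λ m n → ⟦ tlᶠ ∘ᶠ foldᶠ (foldStep (fun h)) ⟧ (m ▹ code Γ e ▹ n))
    (≡-trans (cong ⟦ reverseᶠ ⟧ (fun-correct l e)) (reverseᶠ-correct {σ} (⟪ l ⟫ e)))
    (fun-correct z e))
  (≡-trans (folded (⟪ z ⟫ e) (reverse (⟪ l ⟫ e)))
    (cong (code τ) (reverse-foldl (λ b a → ⟪ h ⟫ (e , a , b)) (⟪ z ⟫ e) (⟪ l ⟫ e))))
  where
  go : ∀ b l → foldl (λ a x → ⟦ foldStep (fun h) ⟧ (x ▹ a)) (code Γ e ▹ code τ b) (map (code σ) l) ≡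
       code Γ e ▹ code τ (foldl (λ b a → ⟪ h ⟫ (e , a , b)) b l)
  go b [] = refl
  go b (a ∷ l) rewrite foldStep-correct (fun h) (code Γ e) (code σ a) (code τ b)
                     | fun-correct h (e , a , b) = go (⟪ h ⟫ (e , a , b)) l
  folded : ∀ b l → ⟦ tlᶠ ∘ᶠ foldᶠ (foldStep (fun h)) ⟧ (code (list σ) l ▹ code Γ e ▹ code τ b) ≡
           code τ (foldl (λ b a → ⟪ h ⟫ (e , a , b)) b l)
  folded b l rewrite hd-▹ (code (list σ) l) (code Γ e ▹ code τ b)
                   | tl-▹ (code (list σ) l) (code Γ e ▹ code τ b)
                   | elems-listCode (map (code σ) l) | go b l = tl-▹ (code Γ e) _
fun-correct (headᵗ t) e = cong hd (fun-correct t e)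
fun-correct (tailᵗ t) e = cong tl (fun-correct t e)
fun-correct (next t) e = cong suc (fun-correct t e)
fun-correct (decode t) e = ≡-trans (fun-correct t e)
  (≡-trans (sym (listCode-elems (⟪ t ⟫ e))) (cong listCode (sym (map-id (elems (⟪ t ⟫ e))))))
fun-correct (encode t) e = fun-correct t e
fun-correct {τ = τ} (as f t t≗f) e = ≡-trans (fun-correct t e) (cong (code τ) (t≗f e))

not′ : ∀ {Γ} → Tm Γ bool → Tm Γ bool
not′ t = as (λ e → not (⟪ t ⟫ e)) (ite t (const false) (const true)) (λ e → lemma (⟪ t ⟫ e))
  where
  lemma : ∀ b → (if b then false else true) ≡ not b
  lemma false = refl
  lemma true  = refl

and′ or′ : ∀ {Γ} → Tm Γ bool → Tm Γ bool → Tm Γ bool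
and′ t u = as (λ e → ⟪ t ⟫ e ∧ ⟪ u ⟫ e) (ite t u (const false)) (λ e → lemma (⟪ t ⟫ e))
  where
  lemma : ∀ b {c} → (if b then c else false) ≡ b ∧ c
  lemma false = refl
  lemma true  = refl
or′ t u = as (λ e → ⟪ t ⟫ e ∨ ⟪ u ⟫ e) (ite t (const true) u) (λ e → lemma (⟪ t ⟫ e))
  where
  lemma : ∀ b {c} → (if b then true else c) ≡ b ∨ c
  lemma false = refl
  lemma true  = refl

nil′ : ∀ {Γ τ} → Tm Γ (list τ)
nil′ = const []

pattern elem = fst (snd var)
pattern accu = snd (snd var)

map′ : ∀ {Γ σ τ} → Tm (Γ ⊗ σ) τ → Tm Γ (list σ) → Tm Γ (list τ)
map′ h l = as (λ e → map (λ a → ⟪ h ⟫ (e , a)) (⟪ l ⟫ e))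
  (fold (cons (h · pair (fst var) elem) accu) nil′ l) (λ e → sym (map-is-foldr (⟪ l ⟫ e)))

append : ∀ {Γ τ} → Tm Γ (list τ) → Tm Γ (list τ) → Tm Γ (list τ)
append t u = as (λ e → ⟪ t ⟫ e ++ ⟪ u ⟫ e) (fold (cons elem accu) u t) (λ e → lemma (⟪ t ⟫ e) (⟪ u ⟫ e))
  where
  lemma : ∀ {A : Set} (l l' : List A) → foldr _∷_ l' l ≡ l ++ l'
  lemma [] l' = refl
  lemma (a ∷ l) l' = cong (a ∷_) (lemma l l')

concatMap′ : ∀ {Γ σ τ} → Tm (Γ ⊗ σ) (list τ) → Tm Γ (list σ) → Tm Γ (list τ)
concatMap′ h l = as (λ e → concatMap (λ a → ⟪ h ⟫ (e , a)) (⟪ l ⟫ e))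
  (fold (append (h · pair (fst var) elem) accu) nil′ l) (λ e → lemma _ (⟪ l ⟫ e))
  where
  lemma : ∀ {A B : Set} (f : A → List B) l → foldr (λ a b → f a ++ b) [] l ≡ concatMap f l
  lemma f [] = refl
  lemma f (a ∷ l) = cong (f a ++_) (lemma f l)

any′ : ∀ {Γ σ} → Tm (Γ ⊗ σ) bool → Tm Γ (list σ) → Tm Γ bool
any′ h l = as (λ e → any (λ a → ⟪ h ⟫ (e , a)) (⟪ l ⟫ e))
  (fold (or′ (h · pair (fst var) elem) accu) (const false) l) (λ e → lemma _ (⟪ l ⟫ e))
  where
  lemma : ∀ {A : Set} (f : A → Bool) l → foldr (λ a b → f a ∨ b) false l ≡ any f l
  lemma f [] = refl
  lemma f (a ∷ l) = cong (f a ∨_) (lemma f l)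

Tm⇒Recursive : (t : Tm (list bool) bool) → Recursive (λ x → ⟪ t ⟫ x ≡ true)
Tm⇒Recursive t = recursive (fun t ∘ᶠ reverseᶠ) ⟪ t ⟫ λ x →
  ≡-trans (cong ⟦ fun t ⟧ (reverseᶠ-correct {bool} (reverse x)))
    (≡-trans (cong (λ y → ⟦ fun t ⟧ (code (list bool) y)) (reverse-involutive x)) (fun-correct t x))

-- Simulation and diagonalisation programs

-- Machines are interpreted from tables. States: 0, 1, 2 for halting with acc, rej, ??;
-- 3 for the query state; 4, 5 for the answers no, yes; 6 + i for the i-th ordinary state.
-- Symbols are numbered as in Defs, and moves L, R, S are 0, 1, 2.

Conf : Set
Conf = ℕ × List ℕ × List ℕ

moveᶜ : ℕ → ℕ → ℕ → List ℕ → List ℕ → Conf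
moveᶜ s a d l r =
  if d ≡ᵇ 0 then caseList (s , [] , a ∷ tailL r) (λ b l' → s , l' , b ∷ a ∷ tailL r) l
  else if d ≡ᵇ 1 then (s , a ∷ l , tailL r)
  else (s , l , a ∷ tailL r)

queryᶜ : List ℕ → Str
queryᶜ = foldr (λ a q → if a ≡ᵇ 1 then false ∷ q else (if a ≡ᵇ 2 then true ∷ q else [])) []

member : Str → List Str → Bool
member x = any (λ y → code (list bool) y ≡ᵇ code (list bool) x)

retrieve : ℕ → ℕ → ℕ
retrieve table key = foldr (λ x v → if hd x ≡ᵇ key then tl x else v) 0 (elems table)

transition : List ℕ → List ℕ → ℕ → Conf
transition l r t = moveᶜ (hd t) (hd (tl t)) (tl (tl t)) l r

scanᶜ : List ℕ → ℕ
scanᶜ = caseList 0 (λ a _ → a)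

-- A halted configuration is its own successor, so an outcome reached early is still listed when the
-- clock runs out.
stepsᶜ : ℕ → List Str → Conf → List Conf
stepsᶜ table O c@(s , l , r) =
  if (s ≡ᵇ 0) ∨ (s ≡ᵇ 1) ∨ (s ≡ᵇ 2) then c ∷ []
  else if s ≡ᵇ 3 then ((if member (queryᶜ r) O then 5 else 4) , l , r) ∷ []
  else map (transition l r) (elems (retrieve table (s ▹ scanᶜ r)))

-- The second argument is a unary clock.
runᶜ : ℕ → Str → List Str → Conf → List Conf
runᶜ table time O c = foldr (λ _ cs → concatMap (stepsᶜ table O) cs) (c ∷ []) time

halted : ℕ → List Conf → Bool
halted o = any (λ c → proj₁ c ≡ᵇ o)

startsOne : Str → Bool
startsOne = caseList false (λ b _ → b)

allZero : Str → Bool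
allZero = foldr (λ b z → if b then false else z) true

allStrings : Str → List Str
allStrings = foldr (λ _ ys → map (false ∷_) ys ++ map (true ∷_) ys) ([] ∷ [])

-- The same unary number 2ⁿ limits the simulation and counts the lengths reserved after the stage. A
-- query made within the limit therefore cannot reach beyond the reserved lengths.
clock : Str → Str
clock = foldr (λ _ t → t ++ t) (false ∷ [])

-- All-zero strings of the lengths after that of cur, the longest first.
paddings : Str → Str → Str × List Str
paddings cur = foldr (λ _ (z , ps) → false ∷ z , (false ∷ z) ∷ ps) (cur , [])

oracle : Str → List Str → Str → List Str
oracle cur h w = proj₂ (paddings cur (clock cur)) ++ w ∷ h

-- A machine code is the number of the start state consed onto the table. The input symbol 1 is the
-- bit 0.
outcomes : ℕ → Str → List Str → Str → List Conf
outcomes e cur h w = runᶜ (tl e) (clock cur) (oracle cur h w) (hd e , [] , map (λ _ → 1) cur)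

-- Both halves matter: presence of the right verdict reflects overproductivity, absence of the wrong
-- one underproductivity.
conforms : Str → List Conf → Bool
conforms w cs = if startsOne w then halted 0 cs ∧ not (halted 1 cs)
                               else not (halted 0 cs) ∧ halted 1 cs

abstract
  -- A string on which machine e errs; cur if there is none.
  diagonal : ℕ → Str → List Str → Str
  diagonal e cur h =
    foldr (λ w v → if conforms w (outcomes e cur h w) then v else w) cur (allStrings cur)

  diagonal-unfold : ∀ e cur h → foldr (λ w v → if conforms w (outcomes e cur h w) then v else w)
                    cur (allStrings cur) ≡ diagonal e cur h
  diagonal-unfold e cur h = refl

-- The all-zero string of the current length, the strings chosen for the shorter lengths, the
-- number of lengths (in unary) still reserved for all-zero strings, and the current stage.
Stage : Set
Stage = Str × List Str × Str × ℕ

-- Stage `i` treats machine `tl i`. Since `e` is the tail of `a ▹ e` for every `a`, each machine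
-- returns at arbitrarily late stages.
advance : Stage → Stage
advance (cur , h , wait , i) = caseList
  (false ∷ cur , diagonal (tl i) cur h ∷ h , clock cur , suc i)
  (λ _ wait' → false ∷ cur , cur ∷ h , wait' , i) wait

stageAt : Str → Stage
stageAt = foldr (λ _ s → advance s) ([] , [] , [] , 0)

history : Str → List Str
history x = proj₁ (proj₂ (stageAt x))

-- The history at length n covers only the lengths below n. The extra symbol brings in the word of
-- the length of `x`, which is then the head of the history.
inB inA : Str → Bool
inB x = member x (history (false ∷ x))
inA x = allZero x ∧ caseList false (λ w _ → startsOne w) (history (false ∷ x))

-- The same algorithms as typed terms

str conf stage : Ty
str   = list bool
conf  = nat ⊗ list nat ⊗ list nat
stage = str ⊗ list str ⊗ str ⊗ nat

_is_ : ∀ {Γ} → Tm Γ nat → ℕ → Tm Γ bool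
t is n = test t (const n)

tailᵖ : ∀ {Γ} → Tm Γ (list nat) → Tm Γ (list nat)
tailᵖ t = as (λ e → tailL (⟪ t ⟫ e)) (case t nil′ (snd (snd var))) (λ e → lemma (⟪ t ⟫ e))
  where
  lemma : ∀ (r : List ℕ) → caseList [] (λ _ r → r) r ≡ tailL r
  lemma []      = refl
  lemma (_ ∷ _) = refl

moveᵖ : Tm ((nat ⊗ nat ⊗ nat) ⊗ list nat ⊗ list nat) conf
moveᵖ = ite (d is 0)
  (case l (pair s (pair nil′ written))
    (pair (s · fst var) (pair (snd (snd var)) (cons (fst (snd var)) (written · fst var)))))
  (ite (d is 1) (pair s (pair (cons a l) (tailᵖ r))) (pair s (pair l written)))
  where
  s = fst (fst var)
  a = fst (snd (fst var))
  d = snd (snd (fst var))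
  l = fst (snd var)
  r = snd (snd var)
  written = cons a (tailᵖ r)

queryᵖ : Tm (list nat) str
queryᵖ = fold (ite (elem is 1) (cons (const false) accu) (ite (elem is 2) (cons (const true) accu) nil′))
  nil′ var

memberᵖ : Tm (str ⊗ list str) bool
memberᵖ = any′ (test (snd var) (fst (fst var))) (snd var)

findᵖ : Tm (nat ⊗ nat) nat
findᵖ = fold (ite (test (headᵗ elem) (snd (fst var))) (tailᵗ elem) accu) (const 0) (decode (fst var))

transitionᵖ : Tm ((list nat ⊗ list nat) ⊗ nat) conf
transitionᵖ = moveᵖ · pair (pair (headᵗ t) (pair (headᵗ (tailᵗ t)) (tailᵗ (tailᵗ t)))) (fst var)
  where t = snd var

scanᵖ : Tm (list nat) nat
scanᵖ = case var (const 0) (fst (snd var))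

stepsᵖ : Tm ((nat ⊗ list str) ⊗ conf) (list conf)
stepsᵖ = ite (or′ (s is 0) (or′ (s is 1) (s is 2))) (cons (snd var) nil′)
  (ite (s is 3)
    (cons (pair (ite (memberᵖ · pair (queryᵖ · r) (snd (fst var))) (const 5) (const 4)) (snd (snd var))) nil′)
    (map′ (transitionᵖ · pair (snd (snd (fst var))) (snd var))
      (decode (findᵖ · pair (fst (fst var)) (encode (pair s (scanᵖ · r)))))))
  where
  s = fst (snd var)
  r = snd (snd (snd var))

runᵖ : Tm ((nat ⊗ str) ⊗ list str ⊗ conf) (list conf)
runᵖ = fold
  (concatMap′ (stepsᵖ · pair (pair (fst (fst env)) (fst (snd env))) (snd var)) accu)
  (cons (snd (snd var)) nil′) (snd (fst var))
  where env = fst (fst var)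

haltedᵖ : ℕ → Tm (list conf) bool
haltedᵖ o = any′ (elem is o) var

startsOneᵖ allZeroᵖ : Tm str bool
startsOneᵖ = case var (const false) elem
allZeroᵖ   = fold (ite elem (const false) accu) (const true) var

allStringsᵖ : Tm str (list str)
allStringsᵖ = fold
  (append (map′ (cons (const false) (snd var)) accu) (map′ (cons (const true) (snd var)) accu))
  (const ([] ∷ [])) var

clockᵖ : Tm str str
clockᵖ = fold (append accu accu) (const (false ∷ [])) var

paddingsᵖ : Tm (str ⊗ str) (str ⊗ list str)
paddingsᵖ = fold (pair z (cons z (snd accu))) (pair (fst var) nil′) (snd var)
  where z = cons (const false) (fst accu)

oracleᵖ : Tm ((str ⊗ list str) ⊗ str) (list str)
oracleᵖ = append (snd (paddingsᵖ · pair cur (clockᵖ · cur))) (cons (snd var) (snd (fst var)))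
  where cur = fst (fst var)

outcomesᵖ : Tm ((nat ⊗ str ⊗ list str) ⊗ str) (list conf)
outcomesᵖ = runᵖ · pair (pair (tailᵗ e) (clockᵖ · cur))
  (pair (oracleᵖ · pair (snd (fst var)) (snd var)) (pair (headᵗ e) (pair nil′ (map′ (const 1) cur))))
  where
  e   = fst (fst var)
  cur = fst (snd (fst var))

conformsᵖ : Tm (str ⊗ list conf) bool
conformsᵖ = ite (startsOneᵖ · fst var) (and′ h₀ (not′ h₁)) (and′ (not′ h₀) h₁)
  where
  h₀ = haltedᵖ 0 · snd var
  h₁ = haltedᵖ 1 · snd var

diagonalᵖ : Tm (nat ⊗ str ⊗ list str) str
diagonalᵖ = as (λ (e , cur , h) → diagonal e cur h)
  (fold (ite (conformsᵖ · pair elem (outcomesᵖ · pair (fst var) elem)) accu elem)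
    (fst (snd var)) (allStringsᵖ · fst (snd var)))
  (λ (e , cur , h) → diagonal-unfold e cur h)

advanceᵖ : Tm stage stage
advanceᵖ = case wait
  (pair (cons (const false) cur)
    (pair (cons (diagonalᵖ · pair (tailᵗ i) (pair cur h)) h) (pair (clockᵖ · cur) (next i))))
  (pair (cons (const false) (cur · fst var))
    (pair (cons (cur · fst var) (h · fst var)) (pair (snd (snd var)) (i · fst var))))
  where
  cur  = fst var
  h    = fst (snd var)
  wait = fst (snd (snd var))
  i    = snd (snd (snd var))

historyᵖ : Tm str (list str)
historyᵖ = fst (snd (fold (advanceᵖ · accu) (const ([] , [] , [] , 0)) var))

inBᵖ inAᵖ : Tm str bool
inBᵖ = memberᵖ · pair var (historyᵖ · cons (const false) var)
inAᵖ = and′ allZeroᵖ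
  (case (historyᵖ · cons (const false) var) (const false) (startsOneᵖ · elem))

langB langA : Lang
langB x = inB x ≡ true
langA x = inA x ≡ true

langB-recursive : Recursive langB
langB-recursive = Tm⇒Recursive inBᵖ

langA-recursive : Recursive langA
langA-recursive = Tm⇒Recursive inAᵖ

-- Membership, counting, and the form of the two languages

any⇒∃ : ∀ {A : Set} (p : A → Bool) l → any p l ≡ true → ∃ λ a → a ∈ l × p a ≡ true
any⇒∃ p (a ∷ l) eq with p a in pa
... | true = a , here refl , pa
... | false with any⇒∃ p l eq
...   | b , b∈l , pb = b , there b∈l , pb

∈⇒any : ∀ {A : Set} (p : A → Bool) {a l} → a ∈ l → p a ≡ true → any p l ≡ true
∈⇒any p (here refl) pa rewrite pa = refl
∈⇒any p {l = b ∷ l} (there a∈l) pa with p b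
... | true  = refl
... | false = ∈⇒any p a∈l pa

≡ᵇ-true : ∀ {m n} → m ≡ n → (m ≡ᵇ n) ≡ true
≡ᵇ-true {m} {n} eq = Equivalence.to T-≡ (≡⇒≡ᵇ m n eq)

≡ᵇ-sound : ∀ {m n} → (m ≡ᵇ n) ≡ true → m ≡ n
≡ᵇ-sound {m} {n} eq = ≡ᵇ⇒≡ m n (Equivalence.from T-≡ eq)

member⇒∈ : ∀ {x O} → member x O ≡ true → x ∈ O
member⇒∈ {x} {O} eq with any⇒∃ _ O eq
... | y , y∈O , eq' = subst (_∈ O) (code-injective str (≡ᵇ-sound eq')) y∈O

∈⇒member : ∀ {x O} → x ∈ O → member x O ≡ true
∈⇒member {x} x∈O = ∈⇒any _ x∈O (≡ᵇ-true {code str x} refl)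

-- Pigeonhole, by deleting the head of `xs` from `ys`. It bounds the size of B and, through `fresh`,
-- provides unqueried words.
Unique-⊆-length : ∀ {A : Set} {xs ys : List A} → Unique xs → (∀ {x} → x ∈ xs → x ∈ ys) →
                  length xs ≤ length ys
Unique-⊆-length [] _ = z≤n
Unique-⊆-length {xs = x ∷ xs} (x∉xs ∷ unique) xs⊆ys with ∈-∃++ (xs⊆ys (here refl))
... | us , vs , refl = ≤-trans (s≤s (Unique-⊆-length unique xs⊆)) (≤-reflexive length-insert)
  where
  xs⊆ : ∀ {y} → y ∈ xs → y ∈ us ++ vs
  xs⊆ y∈xs with ∈-++⁻ us (xs⊆ys (there y∈xs))
  ... | inj₁ y∈us = ∈-++⁺ˡ y∈us
  ... | inj₂ (here refl) = ⊥-elim (All-lookup x∉xs y∈xs refl)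
  ... | inj₂ (there y∈vs) = ∈-++⁺ʳ us y∈vs
  length-insert : suc (length (us ++ vs)) ≡ length (us ++ x ∷ vs)
  length-insert rewrite length-++ us {vs} | length-++ us {x ∷ vs} = sym (+-suc (length us) (length vs))

allStrings-length : ∀ c {w} → w ∈ allStrings c → length w ≡ length c
allStrings-length [] (here refl) = refl
allStrings-length (_ ∷ c) w∈ with ∈-++⁻ (map (false ∷_) (allStrings c)) w∈
... | inj₁ w∈₀ with ∈-map⁻ (false ∷_) w∈₀
...   | v , v∈ , refl = cong suc (allStrings-length c v∈)
allStrings-length (_ ∷ c) w∈ | inj₂ w∈₁ with ∈-map⁻ (true ∷_) w∈₁
...   | v , v∈ , refl = cong suc (allStrings-length c v∈)

allStrings-complete : ∀ c {w} → length w ≡ length c → w ∈ allStrings c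
allStrings-complete [] {[]} eq = here refl
allStrings-complete (_ ∷ c) {false ∷ w} eq =
  ∈-++⁺ˡ (∈-map⁺ (false ∷_) (allStrings-complete c (suc-injective eq)))
allStrings-complete (_ ∷ c) {true ∷ w} eq =
  ∈-++⁺ʳ (map (false ∷_) (allStrings c)) (∈-map⁺ (true ∷_) (allStrings-complete c (suc-injective eq)))

allStrings-unique : ∀ c → Unique (allStrings c)
allStrings-unique [] = [] ∷ []
allStrings-unique (_ ∷ c) = Unique.++⁺
  (Unique.map⁺ ∷-injectiveʳ (allStrings-unique c)) (Unique.map⁺ ∷-injectiveʳ (allStrings-unique c))
  disjoint
  where
  disjoint : ∀ {w} → w ∈ map (false ∷_) (allStrings c) × w ∈ map (true ∷_) (allStrings c) → ⊥
  disjoint (w∈₀ , w∈₁) with ∈-map⁻ (false ∷_) w∈₀ | ∈-map⁻ (true ∷_) w∈₁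
  ... | _ , _ , refl | _ , _ , ()

allStrings-size : ∀ c → length (allStrings c) ≡ 2 ^ length c
allStrings-size [] = refl
allStrings-size (_ ∷ c) = ≡-trans (length-++ (map (false ∷_) (allStrings c)))
  (cong₂ _+_ (half false) (≡-trans (half true) (sym (+-identityʳ (2 ^ length c)))))
  where
  half : ∀ b → length (map (b ∷_) (allStrings c)) ≡ 2 ^ length c
  half b = ≡-trans (length-map (b ∷_) (allStrings c)) (allStrings-size c)

-- The fold is a search for the first element failing `p`, with default `d`. Both `diagonal` and
-- `fresh` are such searches.
pick-spec : ∀ {A : Set} (p : A → Bool) d l → let v = foldr (λ w v → if p w then v else w) d l in
            (v ≡ d × (∀ {w} → w ∈ l → p w ≡ true)) ⊎ (v ∈ l × p v ≡ false)
pick-spec p d [] = inj₁ (refl , λ ())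
pick-spec p d (w ∷ l) with p w in pw
... | false = inj₂ (here refl , pw)
... | true with pick-spec p d l
...   | inj₁ (eq , all) = inj₁ (eq , λ { (here refl) → pw ; (there w∈l) → all w∈l })
...   | inj₂ (v∈ , pv) = inj₂ (there v∈ , pv)

zeros : ℕ → Str
zeros n = replicate n false

st : ℕ → Stage
st n = stageAt (zeros n)

hist : ℕ → List Str
hist n = history (zeros n)

chosen : Stage → Str
chosen (cur , h , wait , i) = caseList (diagonal (tl i) cur h) (λ _ _ → cur) wait

-- The only member of B of length n.
word : ℕ → Str
word n = chosen (st n)

stageAt-length : ∀ x → stageAt x ≡ st (length x)
stageAt-length []      = refl
stageAt-length (_ ∷ x) = cong advance (stageAt-length x)

history-length : ∀ x → history x ≡ hist (length x)
history-length x = cong (proj₁ ∘ proj₂) (stageAt-length x)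

advance-cur : ∀ s → proj₁ (advance s) ≡ false ∷ proj₁ s
advance-cur (cur , h , [] , i)    = refl
advance-cur (cur , h , _ ∷ _ , i) = refl

advance-history : ∀ s → proj₁ (proj₂ (advance s)) ≡ chosen s ∷ proj₁ (proj₂ s)
advance-history (cur , h , [] , i)    = refl
advance-history (cur , h , _ ∷ _ , i) = refl

st-cur : ∀ n → proj₁ (st n) ≡ zeros n
st-cur zero    = refl
st-cur (suc n) = ≡-trans (advance-cur (st n)) (cong (false ∷_) (st-cur n))

hist-suc : ∀ n → hist (suc n) ≡ word n ∷ hist n
hist-suc n = advance-history (st n)

diagonal-length : ∀ e cur h → length (diagonal e cur h) ≡ length cur
diagonal-length e cur h rewrite sym (diagonal-unfold e cur h) with pick-spec (λ w → conforms w (outcomes e cur h w)) cur (allStrings cur)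
... | inj₁ (eq , _) = cong length eq
... | inj₂ (v∈ , _) = allStrings-length cur v∈

chosen-length : ∀ s → length (chosen s) ≡ length (proj₁ s)
chosen-length (cur , h , [] , i)    = diagonal-length _ cur h
chosen-length (cur , h , _ ∷ _ , i) = refl

word-length : ∀ n → length (word n) ≡ n
word-length n = ≡-trans (chosen-length (st n)) (≡-trans (cong length (st-cur n)) (length-replicate n))

∈hist⇒ : ∀ n {x} → x ∈ hist n → length x < n × x ≡ word (length x)
∈hist⇒ (suc n) {x} x∈ with subst (x ∈_) (hist-suc n) x∈
... | here refl = s≤s (≤-reflexive (word-length n)) , cong word (sym (word-length n))
... | there x∈' with ∈hist⇒ n x∈'
...   | lt , eq = m≤n⇒m≤1+n lt , eq

word∈hist : ∀ {m n} → m < n → word m ∈ hist n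
word∈hist {m} {suc n} (s≤s m≤n) with m≤n⇒m<n∨m≡n m≤n
... | inj₁ m<n  = subst (word m ∈_) (sym (hist-suc n)) (there (word∈hist m<n))
... | inj₂ refl = subst (word m ∈_) (sym (hist-suc n)) (here refl)

hist-size : ∀ n → length (hist n) ≡ n
hist-size zero = refl
hist-size (suc n) = ≡-trans (cong length (hist-suc n)) (cong suc (hist-size n))

langB⇒word : ∀ x → langB x → x ≡ word (length x)
langB⇒word x bx = proj₂ (∈hist⇒ (suc (length x))
  (subst (x ∈_) (history-length (false ∷ x)) (member⇒∈ bx)))

langB-word : ∀ n → langB (word n)
langB-word n = ∈⇒member (subst (word n ∈_) (sym (history-length (false ∷ word n)))
  (word∈hist (s≤s (≤-reflexive (sym (word-length n))))))

∈hist⇒langB : ∀ n {x} → x ∈ hist n → langB x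
∈hist⇒langB n {x} x∈ = subst langB (sym (proj₂ (∈hist⇒ n x∈))) (langB-word (length x))

langB⇒∈hist : ∀ n x → length x < n → langB x → x ∈ hist n
langB⇒∈hist n x lt bx = subst (_∈ hist n) (sym (langB⇒word x bx)) (word∈hist lt)

langB-sparse : Sparse langB
-- The polynomial 1 + n: one word for each of the lengths from 0 to n.
langB-sparse = 1 ∷ 1 ∷ [] , λ n ws unique all → ≤-trans
  (Unique-⊆-length {ys = hist (suc n)} unique
    (λ {w} w∈ → langB⇒∈hist (suc n) w (s≤s (proj₂ (All-lookup all w∈))) (proj₁ (All-lookup all w∈))))
  (≤-reflexive (≡-trans (hist-size (suc n)) (cong suc (sym (≡-trans
    (cong (n *_) (cong suc (*-zeroʳ n))) (*-identityʳ n))))))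

∧-true : ∀ {a b} → a ∧ b ≡ true → a ≡ true × b ≡ true
∧-true {true} eq = refl , eq

allZero⇒zeros : ∀ x → allZero x ≡ true → x ≡ zeros (length x)
allZero⇒zeros []          _  = refl
allZero⇒zeros (false ∷ x) eq = cong (false ∷_) (allZero⇒zeros x eq)

allZero-zeros : ∀ n → allZero (zeros n) ≡ true
allZero-zeros zero    = refl
allZero-zeros (suc n) = allZero-zeros n

langA-tally : Tally langA
langA-tally w aw = go w (proj₁ (∧-true aw))
  where
  go : ∀ w → allZero w ≡ true → All (_≡ false) w
  go []          _  = []
  go (false ∷ w) eq = refl ∷ go w eq

inA-eq : ∀ x → inA x ≡ allZero x ∧ startsOne (word (length x))
inA-eq x = cong (λ h → allZero x ∧ caseList false (λ w _ → startsOne w) h)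
  (≡-trans (history-length (false ∷ x)) (hist-suc (length x)))

langA⇒ : ∀ x → langA x → x ≡ zeros (length x) × startsOne (word (length x)) ≡ true
langA⇒ x ax with ∧-true (≡-trans (sym (inA-eq x)) ax)
... | z , s = allZero⇒zeros x z , s

langA-zeros : ∀ n → startsOne (word n) ≡ true → langA (zeros n)
langA-zeros n s = ≡-trans (inA-eq (zeros n)) (cong₂ _∧_ (allZero-zeros n)
  (≡-trans (cong (startsOne ∘ word) (length-replicate n)) s))

-- The strong nondeterministic reduction of A to B

-- A bounded computation tree, all of whose paths end in an outcome satisfying `P`. A trivial `P`
-- leaves the time bound; a restrictive one says which outcomes can occur.
data Runs (M : Machine) (D : Lang) (P : Outcome → Set) : ℕ → Config M → Set where
  done : ∀ {n o t} → P o → Runs M D P n (halt o , t)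
  more : ∀ {n c t} → (∀ {c'} → Step M D (ctrl c , t) c' → Runs M D P n c') →
         Runs M D P (suc n) (ctrl c , t)
  ask  : ∀ {n t} → (∀ {c'} → Step M D (qry , t) c' → Runs M D P n c') →
         Runs M D P (suc n) (qry , t)

Runs-time : ∀ {M D P n c t c'} → Runs M D P n c → Reach M D c t c' → t ≤ n
Runs-time _        here       = z≤n
Runs-time (more f) (next σ ρ) = s≤s (Runs-time (f σ) ρ)
Runs-time (ask f)  (next σ ρ) = s≤s (Runs-time (f σ) ρ)

Runs-outcome : ∀ {M D P n c t o r} → Runs M D P n c → Reach M D c t (halt o , r) → P o
Runs-outcome (done p) here       = p
Runs-outcome (more f) (next σ ρ) = Runs-outcome (f σ) ρ
Runs-outcome (ask f)  (next σ ρ) = Runs-outcome (f σ) ρ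

pattern 0ˢ = zero
pattern 1ˢ = suc zero
pattern 2ˢ = suc (suc zero)
pattern 3ˢ = suc (suc (suc zero))

pattern begin′ = inj₁ zero
pattern guess  = inj₁ (suc zero)
pattern return = inj₁ (suc (suc zero))

-- On 0ⁿ⁺¹ the machine guesses a string of length n + 1, the first bit last (its cell
-- meanwhile holds the end marker 3), and gives the first bit as verdict if the oracle
-- contains the string.
guesser : Machine
guesser = record { nst = 3 ; k = 1 ; start = begin′ ; δ = d }
  where
  d : Ctrl 3 → Sym 1 → List⁺ (State 3 × Sym 1 × Move)
  d begin′ 1ˢ = (ctrl guess , 3ˢ , R) ∷⁺ []
  d begin′ a  = (halt rej , a , S) ∷⁺ []
  d guess  0ˢ = (ctrl return , 0ˢ , L) ∷⁺ []
  d guess  1ˢ = (ctrl guess , 1ˢ , R) ∷⁺ (ctrl guess , 2ˢ , R) ∷ []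
  d guess  a  = (halt rej , a , S) ∷⁺ []
  d return 3ˢ = (qry , 1ˢ , S) ∷⁺ (qry , 2ˢ , S) ∷ []
  d return a  = (ctrl return , a , L) ∷⁺ []
  d (inj₂ true) 1ˢ = (halt rej , 1ˢ , S) ∷⁺ []
  d (inj₂ true) 2ˢ = (halt acc , 2ˢ , S) ∷⁺ []
  d (inj₂ _)    a  = (halt ?? , a , S) ∷⁺ []

returning : List Bool → List Bool → Config guesser
returning []       zs = ctrl return , [] , 3ˢ ∷ map enc zs ++ 0ˢ ∷ []
returning (y ∷ ys) zs = ctrl return , map enc ys ++ 3ˢ ∷ [] , enc y ∷ map enc zs ++ 0ˢ ∷ []

guessing : List Bool → Str → Config guesser
guessing ys x = ctrl guess , map enc ys ++ 3ˢ ∷ [] , map enc x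

answered : Bool → Bool → List Bool → Config guesser
answered a b zs = ctrl (inj₂ a) , [] , enc b ∷ map enc zs ++ 0ˢ ∷ []

query-bits : ∀ zs → query {1} (map enc zs ++ 0ˢ ∷ []) ≡ zs
query-bits []           = refl
query-bits (false ∷ zs) = cong (false ∷_) (query-bits zs)
query-bits (true ∷ zs)  = cong (true ∷_) (query-bits zs)

query-guess : ∀ b zs → query {1} (enc b ∷ map enc zs ++ 0ˢ ∷ []) ≡ b ∷ zs
query-guess b zs = query-bits (b ∷ zs)

module _ {D : Lang} {P : Outcome → Set} where

  private
    answers-run : ∀ a b zs → (a ≡ true → P (verdict b)) → P ?? → Runs guesser D P 1 (answered a b zs)
    answers-run false b     zs p p? = more λ { (trans (here refl)) → done p? }
    answers-run true  false zs p p? = more λ { (trans (here refl)) → done (p refl) }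
    answers-run true  true  zs p p? = more λ { (trans (here refl)) → done (p refl) }

    asks-run : ∀ b zs → (D (b ∷ zs) → P (verdict b)) → P ?? →
               Runs guesser D P 2 (qry , [] , enc b ∷ map enc zs ++ 0ˢ ∷ [])
    asks-run b zs p p? = ask λ
      { (yes d) → answers-run true b zs (λ _ → p (subst D (query-guess b zs) d)) p?
      ; (no ¬d) → answers-run false b zs (λ ()) p? }

  returning-run : ∀ ys zs → (∀ b z → length z ≡ length ys + length zs → D (b ∷ z) → P (verdict b)) →
                  P ?? → Runs guesser D P (length ys + 3) (returning ys zs)
  returning-run [] zs p p? = more λ
    { (trans (here refl))         → asks-run false zs (p false zs refl) p?
    ; (trans (there (here refl))) → asks-run true zs (p true zs refl) p? }
  returning-run (y ∷ ys) zs p p? = back y ys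
    (returning-run ys (y ∷ zs) (λ b z eq → p b z (≡-trans eq (+-suc (length ys) (length zs)))) p?)
    where
    back : ∀ {n} y ys → Runs guesser D P n (returning ys (y ∷ zs)) →
           Runs guesser D P (suc n) (returning (y ∷ ys) zs)
    back false []      run = more λ { (trans (here refl)) → run }
    back true  []      run = more λ { (trans (here refl)) → run }
    back false (_ ∷ _) run = more λ { (trans (here refl)) → run }
    back true  (_ ∷ _) run = more λ { (trans (here refl)) → run }

  -- The time is one pass right over `x`, one pass left over `x` and `ys`, and four steps: turning
  -- at the blank, replacing the marker, the query and the verdict.
  guessing-run : ∀ ys x → allZero x ≡ true →
    (∀ b z → length z ≡ length ys + length x → D (b ∷ z) → P (verdict b)) → P ?? →
    Runs guesser D P (length x + (length x + length ys) + 4) (guessing ys x)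
  guessing-run [] [] _ p p? = more λ { (trans (here refl)) → returning-run [] [] p p? }
  guessing-run (y ∷ ys) [] _ p p? = subst (λ n → Runs guesser D P n (guessing (y ∷ ys) []))
    (sym (+-suc (length (y ∷ ys)) 3))
    (more λ { (trans (here refl)) → returning-run (y ∷ ys) [] p p? })
  guessing-run ys (false ∷ x) z p p? = more λ
    { (trans (here refl))         → next-guess false
    ; (trans (there (here refl))) → next-guess true }
    where
    next-guess : ∀ b → Runs guesser D P (length x + (suc (length x) + length ys) + 4) (guessing (b ∷ ys) x)
    next-guess b = subst (λ n → Runs guesser D P (length x + n + 4) (guessing (b ∷ ys) x))
      (+-suc (length x) (length ys))
      (guessing-run (b ∷ ys) x z (λ b z eq → p b z (≡-trans eq (sym (+-suc (length ys) (length x))))) p?)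

  guessing-rejects : ∀ ys x → allZero x ≡ false → P rej →
    Runs guesser D P (length x) (guessing ys x)
  guessing-rejects ys (true ∷ x) _ p = more λ { (trans (here refl)) → done p }
  guessing-rejects ys (false ∷ x) z p = more λ
    { (trans (here refl))         → guessing-rejects (false ∷ ys) x z p
    ; (trans (there (here refl))) → guessing-rejects (true ∷ ys) x z p }

  guesser-run : ∀ {n} → (∀ b z → suc (length z) ≡ suc n → D (b ∷ z) → P (verdict b)) → P ?? →
    Runs guesser D P (n + (n + 0) + 5) (initial guesser (zeros (suc n)))
  guesser-run {n} p p? = subst (λ m → Runs guesser D P m (initial guesser (zeros (suc n))))
    (≡-trans (cong (λ m → suc (m + (m + 0) + 4)) (length-replicate n)) (sym (+-suc _ 4)))
    (more λ { (trans (here refl)) → guessing-run [] (zeros n) (allZero-zeros n)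
      (λ b z eq → p b z (cong suc (≡-trans eq (length-replicate n)))) p? })

  guesser-rejects : ∀ b x → allZero (b ∷ x) ≡ false → P rej →
    Runs guesser D P (suc (length x)) (initial guesser (b ∷ x))
  guesser-rejects true x _ p = more λ { (trans (here refl)) → done p }
  guesser-rejects false x z p = more λ { (trans (here refl)) → guessing-rejects [] x z p }

  guesser-rejects-[] : P rej → Runs guesser D P 1 (initial guesser [])
  guesser-rejects-[] p = more λ { (trans (here refl)) → done p }

guesser-timed : ∀ D x t c → Reach guesser D (initial guesser x) t c → t ≤ eval (5 ∷ 2 ∷ []) (length x)
guesser-timed D [] t c ρ = ≤-trans (Runs-time (guesser-rejects-[] {P = λ _ → ⊤} tt) ρ) (s≤s z≤n)
guesser-timed D x@(b ∷ x') t c ρ with allZero x in eq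
... | false = ≤-trans (Runs-time (guesser-rejects {P = λ _ → ⊤} b x' eq tt) ρ)
  (≤-trans (m≤m*n (length x) (2 + length x * 0)) (m≤n+m _ 5))
... | true = ≤-trans
  (Runs-time (guesser-run {P = λ _ → ⊤} (λ _ _ _ _ → tt) tt)
    (subst (λ x → Reach guesser D (initial guesser x) t c) (allZero⇒zeros x eq) ρ))
  (≤-trans (≤-reflexive (+-comm (n + (n + 0)) 5)) (+-monoʳ-≤ 5
    (≤-trans (*-monoʳ-≤ 2 (n≤1+n n)) (≤-reflexive (≡-trans (*-comm 2 (suc n))
      (cong (suc n *_) (cong (2 +_) (sym (*-zeroʳ (suc n))))))))))
  where n = length x'

guesser-NPTM : NPTM
guesser-NPTM = record { machine = guesser ; bound = 5 ∷ 2 ∷ [] ; timed = guesser-timed }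

module _ {D : Lang} where

  private
    stepped : ∀ {c c' c''} → Step guesser D c c' → Reaches guesser D c' c'' → Reaches guesser D c c''
    stepped σ (_ , ρ) = _ , next σ ρ

  verdict-reached : ∀ b zs → D (b ∷ zs) → ∃ λ r →
    Reaches guesser D (returning [] zs) (halt (verdict b) , r)
  verdict-reached false zs d = _ , stepped (trans (here refl))
    (stepped (yes (subst D (sym (query-guess false zs)) d)) (stepped (trans (here refl)) (_ , here)))
  verdict-reached true zs d = _ , stepped (trans (there (here refl)))
    (stepped (yes (subst D (sym (query-guess true zs)) d)) (stepped (trans (here refl)) (_ , here)))

  returned : ∀ ys zs → Reaches guesser D (returning ys zs) (returning [] (ys ʳ++ zs))
  returned []               zs = _ , here
  returned (false ∷ [])     zs = stepped (trans (here refl)) (_ , here)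
  returned (true ∷ [])      zs = stepped (trans (here refl)) (_ , here)
  returned (false ∷ y ∷ ys) zs = stepped (trans (here refl)) (returned (y ∷ ys) (false ∷ zs))
  returned (true ∷ y ∷ ys)  zs = stepped (trans (here refl)) (returned (y ∷ ys) (true ∷ zs))

  guessed : ∀ ys gs → Reaches guesser D (guessing ys (zeros (length gs))) (returning (gs ʳ++ ys) [])
  guessed []       []           = stepped (trans (here refl)) (_ , here)
  guessed (y ∷ ys) []           = stepped (trans (here refl)) (_ , here)
  guessed ys       (false ∷ gs) = stepped (trans (here refl)) (guessed (false ∷ ys) gs)
  guessed ys       (true ∷ gs)  = stepped (trans (there (here refl))) (guessed (true ∷ ys) gs)

  guesser-out : ∀ b gs → D (b ∷ gs) → Out guesser D (zeros (suc (length gs))) (verdict b)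
  guesser-out b gs d with verdict-reached b gs d
  ... | r , ρ with stepped (trans (here refl)) (Reaches-trans (guessed [] gs)
      (Reaches-trans (returned (reverse gs) [])
        (subst (λ zs → Reaches guesser D (returning [] zs) (halt (verdict b) , r))
          (sym (reverse-involutive gs)) ρ)))
  ...   | t , ρ' = t , r , ρ'

first-bit : ∀ n {b z} → suc (length z) ≡ suc n → langB (b ∷ z) → b ≡ startsOne (word (suc n))
first-bit n {b} {z} eq d = cong startsOne (≡-trans (langB⇒word (b ∷ z) d) (cong word eq))

-- B has a single word of length n + 1, so all guesses confirmed by the oracle share their first
-- bit.
guesser-only : ∀ n {o} → Out guesser langB (zeros (suc n)) o →
               o ≡ ?? ⊎ o ≡ verdict (startsOne (word (suc n)))
guesser-only n (_ , _ , ρ) = Runs-outcome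
  (guesser-run {P = λ o → o ≡ ?? ⊎ o ≡ verdict (startsOne (word (suc n)))}
    (λ b z eq d → inj₂ (cong verdict (first-bit n {b} {z} eq d))) (inj₁ refl)) ρ

guesser-verdict : ∀ n → Out guesser langB (zeros (suc n)) (verdict (startsOne (word (suc n))))
guesser-verdict n = exists (word (suc n)) (word-length (suc n)) (langB-word (suc n))
  where
  exists : ∀ w → length w ≡ suc n → langB w → Out guesser langB (zeros (suc n)) (verdict (startsOne w))
  exists (b ∷ gs) eq d = subst (λ n → Out guesser langB (zeros n) (verdict b)) eq (guesser-out b gs d)

data Shape : Str → Set where
  empty    : Shape []
  tally    : ∀ n → Shape (zeros (suc n))
  nontally : ∀ {b x} → allZero (b ∷ x) ≡ false → Shape (b ∷ x)

shape : ∀ x → Shape x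
shape [] = empty
shape (b ∷ x) with allZero (b ∷ x) in eq
... | false = nontally eq
... | true  = subst Shape (sym (allZero⇒zeros (b ∷ x) eq)) (tally (length x))

guesser-rejected : ∀ {D b x} → allZero (b ∷ x) ≡ false → Out guesser D (b ∷ x) rej
guesser-rejected {b = true} eq = _ , _ , next (trans (here refl)) here
guesser-rejected {D} {false} {x} eq with go [] x eq
  where
  go : ∀ ys x → allZero x ≡ false → ∃ λ t → ∃ λ r → Reach guesser D (guessing ys x) t (halt rej , r)
  go ys (true ∷ x) eq = _ , _ , next (trans (here refl)) here
  go ys (false ∷ x) eq with go (false ∷ ys) x eq
  ... | t , r , ρ = _ , _ , next (trans (here refl)) ρ
... | t , r , ρ = _ , _ , next (trans (here refl)) ρ

langA-≤SN-langB : langA ≤SN langB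
langA-≤SN-langB = guesser-NPTM , over , under , λ x → sound x , complete x
  where
  over : Overproductive guesser-NPTM langB
  over x (¬acc , ¬rej) with shape x
  ... | empty       = ¬rej (_ , _ , next (trans (here refl)) here)
  ... | nontally eq = ¬rej (guesser-rejected eq)
  ... | tally n with startsOne (word (suc n)) | guesser-verdict n
  ...   | true  | o = ¬acc o
  ...   | false | o = ¬rej o

  only-rej : ∀ {b x o} → allZero (b ∷ x) ≡ false → Out guesser langB (b ∷ x) o → o ≡ rej
  only-rej {b} {x} eq (_ , _ , ρ) = Runs-outcome (guesser-rejects {P = _≡ rej} b x eq refl) ρ

  only-rej-[] : ∀ {o} → Out guesser langB [] o → o ≡ rej
  only-rej-[] (_ , _ , ρ) = Runs-outcome (guesser-rejects-[] {P = _≡ rej} refl) ρ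

  under : Underproductive guesser-NPTM langB
  under x (a , r) with shape x
  ... | empty with only-rej-[] a
  ...   | ()
  under x (a , r) | nontally eq with only-rej eq a
  ...   | ()
  under x (a , r) | tally n with startsOne (word (suc n)) | guesser-only n a | guesser-only n r
  ...   | true  | _ | inj₁ ()
  ...   | true  | _ | inj₂ ()
  ...   | false | inj₁ () | _
  ...   | false | inj₂ () | _

  sound : ∀ x → langA x → Out guesser langB x acc
  sound x ax with shape x
  ... | empty = ⊥-elim (empty∉ ax)
    where
    empty∉ : ¬ langA []
    empty∉ a with word 0 | word-length 0 | proj₂ (langA⇒ [] a)
    ... | [] | _ | ()
  ... | nontally eq with ≡-trans (sym eq) (proj₁ (∧-true ax))
  ...   | ()
  sound x ax | tally n = subst (λ b → Out guesser langB (zeros (suc n)) (verdict b))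
    (≡-trans (cong (startsOne ∘ word) (sym (length-replicate (suc n)))) (proj₂ (langA⇒ (zeros (suc n)) ax)))
    (guesser-verdict n)

  complete : ∀ x → Out guesser langB x acc → langA x
  complete x a with shape x
  ... | empty with only-rej-[] a
  ...   | ()
  complete x a | nontally eq with only-rej eq a
  ...   | ()
  complete x a | tally n with guesser-only n a
  ...   | inj₂ eq = langA-zeros (suc n) (accepting _ (sym eq))
    where
    accepting : ∀ b → verdict b ≡ acc → b ≡ true
    accepting true _ = refl

-- Correctness of the simulation

outcomeNumber : Outcome → ℕ
outcomeNumber acc = 0
outcomeNumber rej = 1
outcomeNumber ??  = 2

ctrlNumber : ∀ {n} → Ctrl n → ℕ
ctrlNumber (inj₂ false) = 4
ctrlNumber (inj₂ true)  = 5
ctrlNumber (inj₁ i)     = 6 + toℕ i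

stateNumber : ∀ {n} → State n → ℕ
stateNumber (halt o) = outcomeNumber o
stateNumber qry      = 3
stateNumber (ctrl c) = ctrlNumber c

moveNumber : Move → ℕ
moveNumber L = 0
moveNumber R = 1
moveNumber S = 2

ctrlNumber-injective : ∀ {n} {c c' : Ctrl n} → ctrlNumber c ≡ ctrlNumber c' → c ≡ c'
ctrlNumber-injective {c = inj₂ false} {inj₂ false} eq = refl
ctrlNumber-injective {c = inj₂ true}  {inj₂ true}  eq = refl
ctrlNumber-injective {c = inj₁ i} {inj₁ j} eq = cong inj₁ (toℕ-injective (+-cancelˡ-≡ 6 _ _ eq))
ctrlNumber-injective {c = inj₁ _} {inj₂ false} ()
ctrlNumber-injective {c = inj₁ _} {inj₂ true} ()

stateNumber-halt : ∀ {n} (s : State n) o → stateNumber s ≡ outcomeNumber o → s ≡ halt o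
stateNumber-halt (halt acc) acc eq = refl
stateNumber-halt (halt rej) rej eq = refl
stateNumber-halt (halt ??)  ??  eq = refl
stateNumber-halt qry acc ()
stateNumber-halt qry rej ()
stateNumber-halt qry ?? ()
stateNumber-halt (ctrl (inj₂ false)) acc ()
stateNumber-halt (ctrl (inj₂ false)) rej ()
stateNumber-halt (ctrl (inj₂ false)) ?? ()
stateNumber-halt (ctrl (inj₂ true)) acc ()
stateNumber-halt (ctrl (inj₂ true)) rej ()
stateNumber-halt (ctrl (inj₂ true)) ?? ()
stateNumber-halt (ctrl (inj₁ i)) acc ()
stateNumber-halt (ctrl (inj₁ i)) rej ()
stateNumber-halt (ctrl (inj₁ i)) ?? ()

queryᶜ-correct : ∀ {k} (r : List (Sym k)) → queryᶜ (map toℕ r) ≡ query r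
queryᶜ-correct [] = refl
queryᶜ-correct (zero ∷ r) = refl
queryᶜ-correct (suc zero ∷ r) = cong (false ∷_) (queryᶜ-correct r)
queryᶜ-correct (suc (suc zero) ∷ r) = cong (true ∷_) (queryᶜ-correct r)
queryᶜ-correct (suc (suc (suc _)) ∷ r) = refl

tailL-map : ∀ {A B : Set} (f : A → B) r → tailL (map f r) ≡ map f (tailL r)
tailL-map f []      = refl
tailL-map f (_ ∷ _) = refl

scanᶜ-correct : ∀ {k} (r : List (Sym k)) → scanᶜ (map toℕ r) ≡ toℕ (headSym r)
scanᶜ-correct []      = refl
scanᶜ-correct (_ ∷ _) = refl

module _ (M : Machine) where

  conf-of : Config M → Conf
  conf-of (s , l , r) = stateNumber s , map toℕ l , map toℕ r

  Key : Set
  Key = Ctrl (nst M) × Sym (k M)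

  keyCode rowCode : Key → ℕ
  actionCode : State (nst M) × Sym (k M) × Move → ℕ
  actionCode (s , a , d) = stateNumber s ▹ toℕ a ▹ moveNumber d
  keyCode (c , a) = ctrlNumber c ▹ toℕ a
  rowCode p@(c , a) = keyCode p ▹ listCode (map actionCode (toList (δ M c a)))

  keys : List Key
  keys = cartesianProduct (map inj₁ (allFin (nst M)) ++ inj₂ false ∷ inj₂ true ∷ []) (allFin (3 + k M))

  ∈-keys : ∀ p → p ∈ keys
  ∈-keys (inj₁ i , a) = ∈-cartesianProduct⁺ (∈-++⁺ˡ (∈-map⁺ inj₁ (∈-allFin i))) (∈-allFin a)
  ∈-keys (inj₂ false , a) =
    ∈-cartesianProduct⁺ (∈-++⁺ʳ (map inj₁ (allFin (nst M))) (here refl)) (∈-allFin a)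
  ∈-keys (inj₂ true , a) =
    ∈-cartesianProduct⁺ (∈-++⁺ʳ (map inj₁ (allFin (nst M))) (there (here refl))) (∈-allFin a)

  keyCode-injective : ∀ {p q} → keyCode p ≡ keyCode q → p ≡ q
  keyCode-injective {c , _} {c' , _} eq with ▹-injective (ctrlNumber c) (ctrlNumber c') eq
  ... | eqc , eqa = cong₂ _,_ (ctrlNumber-injective eqc) (toℕ-injective eqa)

  table : ℕ
  table = listCode (map rowCode keys)

  retrieve-correct : ∀ c a → retrieve table (keyCode (c , a)) ≡ listCode (map actionCode (toList (δ M c a)))
  retrieve-correct c a rewrite elems-listCode (map rowCode keys) = go keys (∈-keys (c , a))
    where
    go : ∀ ps → (c , a) ∈ ps →
         foldr (λ x v → if hd x ≡ᵇ keyCode (c , a) then tl x else v) 0 (map rowCode ps) ≡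
         listCode (map actionCode (toList (δ M c a)))
    go (p@(c' , a') ∷ ps) p∈
      rewrite hd-▹ (keyCode p) (listCode (map actionCode (toList (δ M c' a'))))
            | tl-▹ (keyCode p) (listCode (map actionCode (toList (δ M c' a'))))
      with keyCode p ≡ᵇ keyCode (c , a) in eq
    ... | true with keyCode-injective {p} {c , a} (≡ᵇ-sound eq)
    ...   | refl = refl
    go (p ∷ ps) (there p∈) | false = go ps p∈
    go (p ∷ ps) (here refl) | false with ≡-trans (sym eq) (≡ᵇ-true {keyCode p} refl)
    ...   | ()

  transition-correct : ∀ t l r → transition (map toℕ l) (map toℕ r) (actionCode t) ≡ conf-of (apply M t l r)
  transition-correct (s , a , d) l r
    rewrite hd-▹ (stateNumber s) (toℕ a ▹ moveNumber d) | tl-▹ (stateNumber s) (toℕ a ▹ moveNumber d)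
          | hd-▹ (toℕ a) (moveNumber d) | tl-▹ (toℕ a) (moveNumber d) = go d l
    where
    go : ∀ d l → moveᶜ (stateNumber s) (toℕ a) (moveNumber d) (map toℕ l) (map toℕ r) ≡
         conf-of (apply M (s , a , d) l r)
    go L []      = cong (λ r → stateNumber s , [] , toℕ a ∷ r) (tailL-map toℕ r)
    go L (b ∷ l) = cong (λ r → stateNumber s , map toℕ l , toℕ b ∷ toℕ a ∷ r) (tailL-map toℕ r)
    go R l       = cong (λ r → stateNumber s , toℕ a ∷ map toℕ l , r) (tailL-map toℕ r)
    go S l       = cong (λ r → stateNumber s , map toℕ l , toℕ a ∷ r) (tailL-map toℕ r)

  module _ (O : List Str) where

    -- A link between interpreter and machine: `stepsᶜ` equals it under `conf-of`, and it lists the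
    -- successors under `Step`, with halted configurations idling.
    steps : Config M → List (Config M)
    steps c@(halt _ , _)   = c ∷ []
    steps (qry , l , r)    = (ctrl (inj₂ (member (query r) O)) , l , r) ∷ []
    steps (ctrl c , l , r) = map (λ t → apply M t l r) (toList (δ M c (headSym r)))

    stepsᶜ-correct : ∀ c → stepsᶜ table O (conf-of c) ≡ map conf-of (steps c)
    stepsᶜ-correct (halt acc , l , r) = refl
    stepsᶜ-correct (halt rej , l , r) = refl
    stepsᶜ-correct (halt ?? , l , r)  = refl
    stepsᶜ-correct (qry , l , r) rewrite queryᶜ-correct r with member (query r) O
    ... | true  = refl
    ... | false = refl
    stepsᶜ-correct (ctrl c , l , r) = ≡-trans (interpreted c)
      (≡-trans (cong (map _ ∘ elems) (≡-trans (cong (λ a → retrieve table (ctrlNumber c ▹ a)) (scanᶜ-correct r))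
          (retrieve-correct c (headSym r))))
        (≡-trans (cong (map _) (elems-listCode _))
          (≡-trans (sym (map-∘ ts)) (≡-trans (map-cong (λ t → transition-correct t l r) ts) (map-∘ ts)))))
      where
      ts = toList (δ M c (headSym r))
      interpreted : ∀ c → stepsᶜ table O (conf-of (ctrl c , l , r)) ≡
        map (transition (map toℕ l) (map toℕ r)) (elems (retrieve table (ctrlNumber c ▹ scanᶜ (map toℕ r))))
      interpreted (inj₁ _)     = refl
      interpreted (inj₂ false) = refl
      interpreted (inj₂ true)  = refl

    reachable : Str → Config M → List (Config M)
    reachable time c = foldr (λ _ cs → concatMap steps cs) (c ∷ []) time

    runᶜ-correct : ∀ time c → runᶜ table time O (conf-of c) ≡ map conf-of (reachable time c)
    runᶜ-correct [] c = refl
    runᶜ-correct (_ ∷ time) c = ≡-trans (cong (concatMap (stepsᶜ table O)) (runᶜ-correct time c))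
      (≡-trans (concatMap-map (stepsᶜ table O) conf-of (reachable time c))
        (≡-trans (concatMap-cong stepsᶜ-correct (reachable time c))
          (sym (map-concatMap conf-of steps (reachable time c)))))

    oracleLang : Lang
    oracleLang x = x ∈ O

    steps-sound : ∀ c {c'} → c' ∈ steps c → c' ≡ c ⊎ Step M oracleLang c c'
    steps-sound (halt _ , _) (here eq) = inj₁ eq
    steps-sound (qry , l , r) (here refl) with member (query r) O in eq
    ... | true  = inj₂ (yes (member⇒∈ eq))
    ... | false = inj₂ (no (λ x∈O → false≢true (≡-trans (sym eq) (∈⇒member x∈O))))
      where
      false≢true : false ≢ true
      false≢true ()
    steps-sound (ctrl c , l , r) c'∈ with ∈-map⁻ (λ t → apply M t l r) c'∈
    ... | t , t∈ , refl = inj₂ (trans t∈)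

    steps-complete : ∀ {c c'} → Step M oracleLang c c' → c' ∈ steps c
    steps-complete {ctrl c , l , r} (trans t∈) = ∈-map⁺ (λ t → apply M t l r) t∈
    steps-complete {qry , l , r} (yes x∈O) rewrite ∈⇒member x∈O = here refl
    steps-complete {qry , l , r} (no x∉O) with member (query r) O in eq
    ... | true  = ⊥-elim (x∉O (member⇒∈ eq))
    ... | false = here refl

    reachable-sound : ∀ time {c c'} → c' ∈ reachable time c → ∃ λ t → t ≤ length time × Reach M oracleLang c t c'
    reachable-sound [] (here refl) = 0 , z≤n , here
    reachable-sound (_ ∷ time) {c} c'∈ with find∈ (reachable time c) c'∈
      where
      find∈ : ∀ cs {c'} → c' ∈ concatMap steps cs → ∃ λ d → d ∈ cs × c' ∈ steps d
      find∈ cs c'∈ = find (∈-concatMap⁻ steps {xs = cs} c'∈)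
    ... | d , d∈ , c'∈d with reachable-sound time d∈ | steps-sound d c'∈d
    ...   | t , t≤ , ρ | inj₁ refl = t , m≤n⇒m≤1+n t≤ , ρ
    ...   | t , t≤ , ρ | inj₂ σ = t + 1 , ≤-trans (≤-reflexive (+-comm t 1)) (s≤s t≤) ,
                                  Reach-trans ρ (next σ here)

    unsnoc : ∀ {c t c''} → Reach M oracleLang c (suc t) c'' → ∃ λ c' → Reach M oracleLang c t c' × Step M oracleLang c' c''
    unsnoc {t = zero}  (next σ here) = _ , here , σ
    unsnoc {t = suc t} (next σ ρ) with unsnoc ρ
    ... | c' , ρ' , τ = c' , next σ ρ' , τ

    reachable-step : ∀ {b time c d c'} → d ∈ reachable time c → c' ∈ steps d → c' ∈ reachable (b ∷ time) c
    reachable-step {time = time} {c} {d} {c'} d∈ c'∈ = ∈-concatMap⁺ steps {xs = reachable time c}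
      (lose d∈ c'∈)

    reachable-exact : ∀ time {c c'} → Reach M oracleLang c (length time) c' → c' ∈ reachable time c
    reachable-exact [] here = here refl
    reachable-exact (b ∷ time) {c} ρ with unsnoc ρ
    ... | c' , ρ' , σ = reachable-step {b} {time} {c} (reachable-exact time ρ') (steps-complete σ)

    reachable-halted : ∀ time {c t o r} → t ≤ length time → Reach M oracleLang c t (halt o , r) →
                       (halt o , r) ∈ reachable time c
    reachable-halted time t≤ ρ with m≤n⇒m<n∨m≡n t≤
    ... | inj₂ refl = reachable-exact time ρ
    reachable-halted (b ∷ time) {c} _ ρ | inj₁ (s≤s t≤) =
      reachable-step {b} {time} {c} (reachable-halted time t≤ ρ) (here refl)

    OutWithin : ℕ → Str → Outcome → Set
    OutWithin n x o = ∃ λ t → t ≤ n × ∃ λ r → Reach M oracleLang (initial M x) t (halt o , r)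

    halted-sound : ∀ time x o →
      halted (outcomeNumber o) (runᶜ table time O (conf-of (initial M x))) ≡ true →
      OutWithin (length time) x o
    halted-sound time x o eq rewrite runᶜ-correct time (initial M x)
      with any⇒∃ (λ c → proj₁ c ≡ᵇ outcomeNumber o) (map conf-of (reachable time (initial M x))) eq
    ... | c , c∈ , eq' with ∈-map⁻ conf-of {xs = reachable time (initial M x)} c∈
    ... | (s , lr) , c∈' , refl with stateNumber-halt s o (≡ᵇ-sound eq') | reachable-sound time {initial M x} c∈'
    ... | refl | t , t≤ , ρ = t , t≤ , lr , ρ

    halted-complete : ∀ time x o → OutWithin (length time) x o →
      halted (outcomeNumber o) (runᶜ table time O (conf-of (initial M x))) ≡ true
    halted-complete time x o (t , t≤ , r , ρ) rewrite runᶜ-correct time (initial M x) =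
      ∈⇒any (λ c → proj₁ c ≡ᵇ outcomeNumber o) (∈-map⁺ conf-of (reachable-halted time t≤ ρ)) (≡ᵇ-true {outcomeNumber o} refl)

  machineCode : ℕ
  machineCode = ctrlNumber (start M) ▹ table

  outcomes-code : ∀ n h w → outcomes machineCode (zeros n) h w ≡
    runᶜ table (clock (zeros n)) (oracle (zeros n) h w) (conf-of (initial M (zeros n)))
  outcomes-code n h w rewrite hd-▹ (ctrlNumber (start M)) table | tl-▹ (ctrlNumber (start M)) table =
    cong (λ r → runᶜ table (clock (zeros n)) (oracle (zeros n) h w) (ctrlNumber (start M) , [] , r)) (ones n)
    where
    ones : ∀ n → map (λ _ → 1) (zeros n) ≡ map toℕ (map (enc {k M}) (zeros n))
    ones zero    = refl
    ones (suc n) = cong (1 ∷_) (ones n)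

-- The diagonal argument

-- Each Horner step costs one more factor C + n, after `C` has grown by a + 1. The 1 keeps the base
-- positive, so that a power of it may multiply `a`.
eval-bound : ∀ p → ∃ λ C → ∃ λ d → ∀ n → eval p n ≤ (C + n) ^ d
eval-bound [] = 0 , 0 , λ _ → z≤n
eval-bound (a ∷ p) with eval-bound p
... | C , d , bound = suc (a + C) , suc d , λ n → let E = (suc (a + C) + n) ^ d in begin
  a + n * eval p n
    ≤⟨ +-mono-≤ (≤-trans (≤-reflexive (sym (*-identityʳ a))) (*-monoʳ-≤ a (m^n>0 (suc (a + C) + n) d)))
         (*-monoʳ-≤ n (≤-trans (bound n) (^-monoˡ-≤ d (+-monoˡ-≤ n (m≤n+m C (suc a)))))) ⟩
  a * E + n * E
    ≡⟨ *-distribʳ-+ E a n ⟨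
  (a + n) * E
    ≤⟨ *-monoˡ-≤ E (+-monoˡ-≤ n (≤-trans (m≤m+n a C) (n≤1+n (a + C)))) ⟩
  (suc (a + C) + n) * E ∎
  where open ≤-Reasoning

n<2^n : ∀ n → n < 2 ^ n
n<2^n zero = s≤s z≤n
n<2^n (suc n) = begin
  suc (suc n)   ≤⟨ s≤s (n<2^n n) ⟩
  1 + 2 ^ n     ≤⟨ +-monoˡ-≤ (2 ^ n) (m^n>0 2 n) ⟩
  2 ^ n + 2 ^ n ≡⟨ cong (2 ^ n +_) (+-identityʳ (2 ^ n)) ⟨
  2 ^ suc n     ∎
  where open ≤-Reasoning

linear-bound : ∀ a b → ∃ λ j → ∀ q → j ≤ q → a + b * q ≤ 2 ^ q
linear-bound a b = j , λ q j≤q → subst (λ q → a + b * q ≤ 2 ^ q) (m∸n+n≡m j≤q) (go (q ∸ j))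
  where
  open ≤-Reasoning
  -- This `u` gives a + b (2u) ≤ u + u² ≤ (u + 1)² ≤ 2^(2u), because u < 2^u. Beyond `j`, each step
  -- adds `b` on the left and at least `b` on the right.
  u = a + (b + b)
  j = u + u
  base : a + b * j ≤ 2 ^ j
  base = begin
    a + b * (u + u)         ≡⟨ cong (a +_) (≡-trans (*-distribˡ-+ b u u) (sym (*-distribʳ-+ u b b))) ⟩
    a + (b + b) * u         ≤⟨ +-mono-≤ (m≤m+n a (b + b)) (*-monoˡ-≤ u (m≤n+m (b + b) a)) ⟩
    u + u * u               ≤⟨ ≤-trans (m≤n+m _ (suc u)) (≤-reflexive (sym (square u))) ⟩
    suc u * suc u           ≤⟨ *-mono-≤ (n<2^n u) (n<2^n u) ⟩
    2 ^ u * 2 ^ u           ≡⟨ ^-distribˡ-+-* 2 u u ⟨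
    2 ^ (u + u)             ∎
    where
    square : ∀ u → suc u * suc u ≡ suc u + (u + u * u)
    square u = cong (suc u +_) (*-suc u u)
  b≤ : ∀ i → b ≤ 2 ^ (i + j)
  b≤ i = begin
    b           ≤⟨ ≤-trans (m≤n+m b b) (≤-trans (m≤n+m (b + b) a) (≤-trans (m≤m+n u u) (m≤n+m j i))) ⟩
    i + j       ≤⟨ <⇒≤ (n<2^n (i + j)) ⟩
    2 ^ (i + j) ∎
  go : ∀ i → a + b * (i + j) ≤ 2 ^ (i + j)
  go zero = base
  go (suc i) = begin
    a + b * suc (i + j)       ≡⟨ cong (a +_) (*-suc b (i + j)) ⟩
    a + (b + b * (i + j))     ≡⟨ +-assoc a b _ ⟨
    a + b + b * (i + j)       ≡⟨ cong (_+ b * (i + j)) (+-comm a b) ⟩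
    b + a + b * (i + j)       ≡⟨ +-assoc b a _ ⟩
    b + (a + b * (i + j))     ≤⟨ +-mono-≤ (b≤ i) (go i) ⟩
    2 ^ (i + j) + 2 ^ (i + j) ≡⟨ cong (2 ^ (i + j) +_) (+-identityʳ (2 ^ (i + j))) ⟨
    2 ^ suc (i + j)           ∎

-- Division by `d` reduces this to the linear case: for m = r + q d with r < d, the base is at most
-- C + d + d q ≤ 2^q, and (2^q)^d ≤ 2^m.
power-bound : ∀ C d → ∃ λ j → ∀ m → j ≤ m → (C + m) ^ d ≤ 2 ^ m
power-bound C zero = 0 , λ m _ → m^n>0 2 m
power-bound C d@(suc _) with linear-bound (C + d) d
... | j , bound = j * d , λ m jd≤m → let q = m / d in begin
  (C + m) ^ d
    ≡⟨ cong (λ m → (C + m) ^ d) (m≡m%n+[m/n]*n m d) ⟩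
  (C + (m % d + q * d)) ^ d
    ≤⟨ ^-monoˡ-≤ d (+-monoʳ-≤ C (+-mono-≤ (<⇒≤ (m%n<n m d)) (≤-reflexive (*-comm q d)))) ⟩
  (C + (d + d * q)) ^ d
    ≡⟨ cong (_^ d) (+-assoc C d (d * q)) ⟨
  (C + d + d * q) ^ d
    ≤⟨ ^-monoˡ-≤ d (bound q (≤-trans (≤-reflexive (sym (m*n/n≡m j d))) (/-monoˡ-≤ d jd≤m))) ⟩
  (2 ^ q) ^ d
    ≡⟨ ^-*-assoc 2 q d ⟩
  2 ^ (q * d)
    ≤⟨ ^-monoʳ-≤ 2 (≤-trans (m≤n+m (q * d) (m % d)) (≤-reflexive (sym (m≡m%n+[m/n]*n m d)))) ⟩
  2 ^ m ∎
  where open ≤-Reasoning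

-- The square comes from p + 1 accepting paths with up to p queries each. The right side is 2ᵐ
-- because that many words of length m + 1 share a given first bit.
growth : ∀ p → ∃ λ j → ∀ m → j ≤ m → suc (eval p (suc m)) * suc (eval p (suc m)) ≤ 2 ^ m
growth p with eval-bound p
... | C , d , bound with power-bound (2 + C) (suc d + suc d)
-- The base 2 + C + m exceeds C + (m + 1) and is at least 2. One extra factor therefore absorbs the
-- successor, and squaring doubles the exponent.
...   | j , power = j , λ m j≤m → let x = 2 + C + m in begin
  suc (eval p (suc m)) * suc (eval p (suc m)) ≤⟨ *-mono-≤ (small m) (small m) ⟩
  x ^ suc d * x ^ suc d                       ≡⟨ ^-distribˡ-+-* x (suc d) (suc d) ⟨
  x ^ (suc d + suc d)                         ≤⟨ power m j≤m ⟩
  2 ^ m                                       ∎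
  where
  open ≤-Reasoning
  small : ∀ m → suc (eval p (suc m)) ≤ (2 + C + m) ^ suc d
  small m = let x = 2 + C + m in begin
    suc (eval p (suc m)) ≤⟨ s≤s (bound (suc m)) ⟩
    suc ((C + suc m) ^ d) ≤⟨ s≤s (^-monoˡ-≤ d (≤-trans (≤-reflexive (+-suc C m)) (n≤1+n _))) ⟩
    1 + x ^ d            ≤⟨ +-monoˡ-≤ (x ^ d) (m^n>0 x d) ⟩
    x ^ d + x ^ d        ≡⟨ cong (x ^ d +_) (+-identityʳ (x ^ d)) ⟨
    2 * x ^ d            ≤⟨ *-monoˡ-≤ (x ^ d) {2} {x} (s≤s (s≤s z≤n)) ⟩
    x ^ suc d            ∎

clock-length : ∀ x → length (clock x) ≡ 2 ^ length x
clock-length []      = refl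
clock-length (_ ∷ x) = ≡-trans (length-++ (clock x))
  (cong₂ _+_ (clock-length x) (≡-trans (clock-length x) (sym (+-identityʳ (2 ^ length x)))))

paddings-length : ∀ cur t → paddings cur t ≡ paddings cur (zeros (length t))
paddings-length cur []      = refl
paddings-length cur (_ ∷ t) = cong (λ (z , ps) → false ∷ z , (false ∷ z) ∷ ps) (paddings-length cur t)

paddings-zeros : ∀ n j → proj₁ (paddings (zeros n) (zeros j)) ≡ zeros (j + n)
paddings-zeros n zero    = refl
paddings-zeros n (suc j) = cong (false ∷_) (paddings-zeros n j)

drop-lookup : ∀ {A : Set} j (l : List A) → j < length l → ∃ λ a → drop j l ≡ a ∷ drop (suc j) l
drop-lookup zero    (a ∷ l) _         = a , refl
drop-lookup (suc j) (_ ∷ l) (s≤s j<l) = drop-lookup j l j<l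

drop-all : ∀ {A : Set} (l : List A) → drop (length l) l ≡ []
drop-all []      = refl
drop-all (_ ∷ l) = drop-all l

StageAt : ℕ → ℕ → Set
StageAt i n = st n ≡ (zeros n , hist n , [] , i)

-- While waiting, the chosen word is always the current all-zero string, and these are the strings
-- that `paddings` supplied to the simulation in advance.
wait-runs-down : ∀ n {h wait i} → st (suc n) ≡ (zeros (suc n) , h , wait , i) → ∀ j → j ≤ length wait →
  st (j + suc n) ≡ (zeros (j + suc n) , proj₂ (paddings (zeros n) (zeros j)) ++ h , drop j wait , i)
wait-runs-down n eq zero _ = eq
wait-runs-down n {h} {wait} {i} eq (suc j) j<
  with drop-lookup j wait j< | wait-runs-down n eq j (<⇒≤ j<)
... | a , eqd | ih rewrite eqd = ≡-trans (cong advance ih)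
  (cong (λ z → false ∷ zeros (j + suc n) , z ∷ proj₂ (paddings (zeros n) (zeros j)) ++ h , drop (suc j) wait , i)
    (≡-trans (cong zeros (+-suc j n)) (cong (false ∷_) (sym (paddings-zeros n j)))))

nextStage : ℕ → ℕ
nextStage n = length (clock (zeros n)) + suc n

stage-runs : ∀ {i n} → StageAt i n →
  st (nextStage n) ≡ (zeros (nextStage n) , oracle (zeros n) (hist n) (word n) , [] , suc i)
stage-runs {i} {n} at-stage = ≡-trans
  (wait-runs-down n (≡-trans (cong advance at-stage) (cong (λ w → zeros (suc n) , w ∷ hist n , clock (zeros n) , suc i)
      (sym (cong chosen at-stage)))) (length (clock (zeros n))) ≤-refl)
  (cong₂ (λ (_ , ps) wait → zeros (nextStage n) , ps ++ word n ∷ hist n , wait , suc i)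
    (sym (paddings-length (zeros n) (clock (zeros n)))) (drop-all (clock (zeros n))))

-- Every stage uses up at least one length, hence `i ≤ n`: a late stage means a long input.
stage-exists : ∀ i → ∃ λ n → i ≤ n × StageAt i n
stage-exists zero = 0 , z≤n , refl
stage-exists (suc i) with stage-exists i
... | n , i≤n , at-stage = nextStage n , ≤-trans (s≤s i≤n) (m≤n+m (suc n) _) ,
  ≡-trans (stage-runs at-stage)
    (cong (λ h → zeros (nextStage n) , h , [] , suc i) (sym (cong (proj₁ ∘ proj₂) (stage-runs at-stage))))

stage-word : ∀ {i n} → StageAt i n → word n ≡ diagonal (tl i) (zeros n) (hist n)
stage-word at-stage = cong chosen at-stage

-- Until the next stage, B looks as it did in the simulations of stage n.
stage-oracle : ∀ {i n} → StageAt i n → hist (nextStage n) ≡ oracle (zeros n) (hist n) (word n)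
stage-oracle at-stage = cong (proj₁ ∘ proj₂) (stage-runs at-stage)

-- Paths and the oracle strings they query

queries : ∀ {M D c t c'} → Reach M D c t c' → List Str
queries here                     = []
queries (next (trans _) ρ)       = queries ρ
queries (next (yes {r = r} _) ρ) = query r ∷ queries ρ
queries (next (no {r = r} _) ρ)  = query r ∷ queries ρ

queries-length : ∀ {M D c t c'} (ρ : Reach M D c t c') → length (queries ρ) ≤ t
queries-length here               = z≤n
queries-length (next (trans _) ρ) = m≤n⇒m≤1+n (queries-length ρ)
queries-length (next (yes _) ρ)   = s≤s (queries-length ρ)
queries-length (next (no _) ρ)    = s≤s (queries-length ρ)

-- Oracles are arbitrary predicates, possibly undecidable. The two implications are just what the
-- `yes` and `no` steps of a path need in `transfer`.
Agree : Lang → Lang → Str → Set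
Agree D D' x = (D x → D' x) × (¬ D x → ¬ D' x)

transfer : ∀ {M D D' c t c'} (ρ : Reach M D c t c') → (∀ {x} → x ∈ queries ρ → Agree D D' x) →
           Reach M D' c t c'
transfer here agree = here
transfer (next (trans t∈) ρ) agree = next (trans t∈) (transfer ρ agree)
transfer (next (yes d) ρ)    agree = next (yes (proj₁ (agree (here refl)) d)) (transfer ρ (agree ∘ there))
transfer (next (no ¬d) ρ)    agree = next (no (proj₂ (agree (here refl)) ¬d)) (transfer ρ (agree ∘ there))

width : ∀ {M} → Config M → ℕ
width (_ , l , r) = length l + length r

tailL-length : ∀ {A : Set} (r : List A) → length (tailL r) ≤ length r
tailL-length []      = z≤n
tailL-length (_ ∷ r) = n≤1+n _

apply-width : ∀ M t l r → width {M} (apply M t l r) ≤ suc (length l + length r)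
apply-width M (s , a , L) []      r = s≤s (tailL-length r)
apply-width M (s , a , L) (b ∷ l) r = ≤-trans
  (≤-reflexive (≡-trans (+-suc (length l) _) (cong suc (+-suc (length l) _))))
  (s≤s (s≤s (+-monoʳ-≤ (length l) (tailL-length r))))
apply-width M (s , a , R) l       r = s≤s (+-monoʳ-≤ (length l) (tailL-length r))
apply-width M (s , a , S) l       r =
  ≤-trans (≤-reflexive (+-suc (length l) _)) (s≤s (+-monoʳ-≤ (length l) (tailL-length r)))

query-length : ∀ {k} (r : List (Sym k)) → length (query r) ≤ length r
query-length [] = z≤n
query-length (a ∷ r) with bit? a
... | just _  = s≤s (query-length r)
... | nothing = z≤n

-- A query is a piece of the tape, and a step adds at most one cell.
queries-width : ∀ {M D c t c'} (ρ : Reach M D c t c') {x} → x ∈ queries ρ → length x ≤ width {M} c + t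
queries-width {M} {c = ctrl _ , l , r} (next {t = t} (trans {t = a} _) ρ) x∈ = ≤-trans (queries-width ρ x∈)
  (≤-trans (+-monoˡ-≤ t (apply-width M a l r)) (≤-reflexive (sym (+-suc (length l + length r) t))))
queries-width {c = qry , l , r} (next (yes _) ρ) (here refl) =
  ≤-trans (query-length r) (≤-trans (m≤n+m _ (length l)) (m≤m+n _ _))
queries-width {c = qry , l , r} (next (no _) ρ) (here refl) =
  ≤-trans (query-length r) (≤-trans (m≤n+m _ (length l)) (m≤m+n _ _))
queries-width {c = qry , l , r} (next (yes _) ρ) (there x∈) =
  ≤-trans (queries-width ρ x∈) (+-monoʳ-≤ (length l + length r) (n≤1+n _))
queries-width {c = qry , l , r} (next (no _) ρ) (there x∈) =
  ≤-trans (queries-width ρ x∈) (+-monoʳ-≤ (length l + length r) (n≤1+n _))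

fresh : ∀ {ys qs : List Str} → Unique ys → length qs < length ys → ∃ λ y → y ∈ ys × y ∉ qs
fresh {[]} _ ()
fresh {ys@(y₀ ∷ _)} {qs} unique qs<ys with pick-spec (λ y → member y qs) y₀ ys
... | inj₁ (_ , all) = ⊥-elim (<⇒≱ qs<ys (Unique-⊆-length {ys = qs} unique (λ {y} y∈ → member⇒∈ {y} {qs} (all y∈))))
... | inj₂ (y∈ , ¬m) = _ , y∈ , λ y∈qs → true≢false (≡-trans (sym (∈⇒member y∈qs)) ¬m)
  where
  true≢false : true ≢ false
  true≢false ()

block : Bool → ℕ → List Str
block b m = map (b ∷_) (allStrings (zeros m))

block-unique : ∀ b m → Unique (block b m)
block-unique b m = Unique.map⁺ ∷-injectiveʳ (allStrings-unique (zeros m))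

block-size : ∀ b m → length (block b m) ≡ 2 ^ m
block-size b m = ≡-trans (length-map (b ∷_) (allStrings (zeros m)))
  (≡-trans (allStrings-size (zeros m)) (cong (2 ^_) (length-replicate m)))

∈-block⇒ : ∀ b m {y} → y ∈ block b m → startsOne y ≡ b × y ∈ allStrings (zeros (suc m))
∈-block⇒ b m y∈ with ∈-map⁻ (b ∷_) y∈
... | z , z∈ , refl = refl , allStrings-complete (zeros (suc m)) (cong suc (allStrings-length (zeros m) z∈))

conforms-one : ∀ {w cs} → startsOne w ≡ true → conforms w cs ≡ halted 0 cs ∧ not (halted 1 cs)
conforms-one eq rewrite eq = refl

conforms-zero : ∀ {w cs} → startsOne w ≡ false → conforms w cs ≡ not (halted 0 cs) ∧ halted 1 cs
conforms-zero eq rewrite eq = refl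

not-true : ∀ {b} → not b ≡ true → b ≢ true
not-true {false} _ ()

bool-cases : ∀ b → b ≡ true ⊎ b ≡ false
bool-cases true  = inj₁ refl
bool-cases false = inj₂ refl

-- No robust machine is correct for every word

module Diagonalisation (N : NPTM) (m : ℕ)
  (sparse-paths : suc (eval (bound N) (suc m)) * suc (eval (bound N) (suc m)) ≤ 2 ^ m)
  (h pads : List Str) where

  M = machine N
  n = suc m
  p = eval (bound N) n

  p<2^m : p < 2 ^ m
  p<2^m = ≤-trans (m≤m*n (suc p) (suc p)) sparse-paths

  outOf : Lang → Outcome → Set
  outOf D = Out M D (zeros n)

  path-short : ∀ {D t c} → Reach M D (initial M (zeros n)) t c → t ≤ p
  path-short {D} {t} {c} ρ =
    subst (λ n → t ≤ eval (bound N) n) (length-replicate n) (timed N D (zeros n) t c ρ)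

  queries-few : ∀ {D t c} (ρ : Reach M D (initial M (zeros n)) t c) → length (queries ρ) ≤ p
  queries-few ρ = ≤-trans (queries-length ρ) (path-short ρ)

  base : Lang
  base x = x ∈ pads ++ h

  with-word : Str → Lang
  with-word w x = x ∈ pads ++ w ∷ h

  with-word⇒ : ∀ {w x} → with-word w x → x ≡ w ⊎ base x
  with-word⇒ {w} x∈ with ∈-++⁻ pads x∈
  ... | inj₁ x∈pads      = inj₂ (∈-++⁺ˡ x∈pads)
  ... | inj₂ (here eq)   = inj₁ eq
  ... | inj₂ (there x∈h) = inj₂ (∈-++⁺ʳ pads x∈h)

  base⇒with-word : ∀ {w x} → base x → with-word w x
  base⇒with-word x∈ with ∈-++⁻ pads x∈
  ... | inj₁ x∈pads = ∈-++⁺ˡ x∈pads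
  ... | inj₂ x∈h    = ∈-++⁺ʳ pads (there x∈h)

  word-in : ∀ {w} → with-word w w
  word-in = ∈-++⁺ʳ pads (here refl)

  Correct : Set
  Correct = ∀ {w} → w ∈ allStrings (zeros n) →
    (startsOne w ≡ true  → outOf (with-word w) acc × ¬ outOf (with-word w) rej) ×
    (startsOne w ≡ false → ¬ outOf (with-word w) acc × outOf (with-word w) rej)

  module _ (correct : Correct) where

    private
      -- The path asks at most p < 2ᵐ questions and so misses one of the 2ᵐ words starting with `b`.
      -- Adding that word to the oracle leaves the path intact.
      unqueried-word : ∀ b {o} → outOf base o →
        (∀ {w} → w ∈ block b m → outOf (with-word w) o → ⊥) → ⊥
      unqueried-word b (t , r , ρ) contradictory
        with fresh (block-unique b m) (≤-<-trans (queries-few ρ) (≤-trans p<2^m (≤-reflexive (sym (block-size b m)))))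
      ... | w , w∈ , w∉ = contradictory w∈ (t , r , transfer ρ λ {x} x∈ →
        base⇒with-word , λ ¬base x∈w → case-of (with-word⇒ x∈w) ¬base (λ { refl → w∉ x∈ }))
        where
        case-of : ∀ {A B : Set} → A ⊎ B → ¬ B → ¬ A → ⊥
        case-of (inj₁ a) _ ¬a = ¬a a
        case-of (inj₂ b) ¬b _ = ¬b b

    not-overproductive : ¬ RobustlyOverproductive N
    not-overproductive over = over base (zeros n)
      ( (λ out → unqueried-word false out λ w∈ out' → let s , w∈' = ∈-block⇒ false m w∈ in
          proj₁ (proj₂ (correct w∈') s) out')
      , (λ out → unqueried-word true out λ w∈ out' → let s , w∈' = ∈-block⇒ true m w∈ in
          proj₂ (proj₁ (correct w∈') s) out') )

    -- Containment in a common list `qs` is recorded so that a word outside `qs` is avoided by all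
    -- the collected accepting paths at once.
    Avoiding : List Str → Str → Set
    Avoiding qs y = ∃ λ t → ∃ λ r → Σ (Reach M (with-word y) (initial M (zeros n)) t (halt acc , r))
      λ ρ → ∀ {x} → x ∈ queries ρ → x ∈ qs

    collect : ∀ ys → (∀ {y} → y ∈ ys → outOf (with-word y) acc) →
              ∃ λ qs → length qs ≤ length ys * p × (∀ {y} → y ∈ ys → Avoiding qs y)
    collect [] accepts = [] , z≤n , λ ()
    collect (y ∷ ys) accepts with collect ys (accepts ∘ there) | accepts (here refl)
    ... | qs , few , within | t , r , ρ = queries ρ ++ qs ,
      ≤-trans (≤-reflexive (length-++ (queries ρ))) (+-mono-≤ (queries-few ρ) few) ,
      λ { (here refl) → t , r , ρ , ∈-++⁺ˡ
        ; (there y∈) → let t' , r' , ρ' , sub = within y∈ in t' , r' , ρ' , ∈-++⁺ʳ (queries ρ) ∘ sub }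

    -- p + 1 accepting paths query at most (p + 1) p strings, so some word z is queried by
    -- none of them; the rejecting path for z misses one of the p + 1 accepted words.
    not-underproductive : ¬ RobustlyUnderproductive N
    not-underproductive under = disagree (collect ys accepts)
      where
      ys = take (suc p) (block true m)
      ys⊆ : ∀ {y} → y ∈ ys → startsOne y ≡ true × y ∈ allStrings (zeros n)
      ys⊆ {y} y∈ = ∈-block⇒ true m (subst (y ∈_) (take++drop≡id (suc p) (block true m)) (∈-++⁺ˡ y∈))
      accepts : ∀ {y} → y ∈ ys → outOf (with-word y) acc
      accepts y∈ = let s , y∈' = ys⊆ y∈ in proj₁ (proj₁ (correct y∈') s)
      ys-size : length ys ≡ suc p
      ys-size = ≡-trans (length-take (suc p) (block true m))
        (m≤n⇒m⊓n≡m (≤-trans p<2^m (≤-reflexive (sym (block-size true m)))))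
      union-few : ∀ {q} → q ≤ length ys * p → q < length (block false m)
      union-few {q} q≤ = begin-strict
        q                    ≤⟨ q≤ ⟩
        length ys * p        ≡⟨ cong (_* p) ys-size ⟩
        suc p * p            <⟨ *-monoʳ-< (suc p) (n<1+n p) ⟩
        suc p * suc p        ≤⟨ sparse-paths ⟩
        2 ^ m                ≡⟨ block-size false m ⟨
        length (block false m) ∎
        where open ≤-Reasoning

      disagree : (∃ λ qs → length qs ≤ length ys * p × (∀ {y} → y ∈ ys → Avoiding qs y)) → ⊥
      disagree (qs , few , within) with fresh (block-unique false m) (union-few few)
      ... | z , z∈ , z∉ with ∈-block⇒ false m z∈
      ... | sz , z∈' with proj₂ (proj₂ (correct z∈') sz)
      ... | tz , rz , ρz
        with fresh {ys} {queries ρz} (Unique.take⁺ (suc p) (block-unique true m))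
               (≤-trans (s≤s (queries-few ρz)) (≤-reflexive (sym ys-size)))
      ... | y , y∈ , y∉ with within y∈
      ... | ty , ry , ρy , ρy⊆qs = under both (zeros n)
        ( (ty , ry , transfer ρy λ x∈ → inj₁ ,
             λ { ¬d (inj₁ d) → ¬d d ; ¬d (inj₂ refl) → z∉ (ρy⊆qs x∈) })
        , (tz , rz , transfer ρz λ x∈ → to-both , λ
             { ¬d (inj₂ refl) → ¬d word-in
             ; ¬d (inj₁ d)    → from-y (with-word⇒ d) x∈ ¬d }) )
        where
        both : Lang
        both x = with-word y x ⊎ x ≡ z
        to-both : ∀ {x} → with-word z x → both x
        to-both d with with-word⇒ d
        ... | inj₁ x≡z  = inj₂ x≡z
        ... | inj₂ base = inj₁ (base⇒with-word base)
        from-y : ∀ {x} → x ≡ y ⊎ base x → x ∈ queries ρz → ¬ with-word z x → ⊥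
        from-y (inj₁ refl) x∈ _  = y∉ x∈
        from-y (inj₂ b)    _  ¬d = ¬d (base⇒with-word b)

private
  conforms⇒ : ∀ {w cs} → conforms w cs ≡ true →
    (startsOne w ≡ true → halted 0 cs ≡ true × halted 1 cs ≢ true) ×
    (startsOne w ≡ false → halted 0 cs ≢ true × halted 1 cs ≡ true)
  conforms⇒ {w} {cs} eq =
    (λ s → let a , b = ∧-true (≡-trans (sym (conforms-one {w} {cs} s)) eq) in a , not-true b) ,
    (λ s → let a , b = ∧-true (≡-trans (sym (conforms-zero {w} {cs} s)) eq) in not-true a , b)

-- A reduction of A to B errs on none of the strings tried at its stages.
reduction-correct : ∀ N → SNvia N langA langB →
  ∃ λ m → Σ (suc (eval (bound N) (suc m)) * suc (eval (bound N) (suc m)) ≤ 2 ^ m) λ sparse-paths →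
  ∃ λ h → ∃ λ pads → Diagonalisation.Correct N m sparse-paths h pads
-- The index has the machine code as its tail, and its head `suc j` pushes the length n = m + 1 of
-- the stage beyond `j`, where `growth` applies.
reduction-correct N (over , under , decides) with growth (bound N)
... | j , grows with stage-exists (suc j ▹ machineCode (machine N))
... | zero , i≤n , _ = ⊥-elim (<⇒≱ (≤-<-trans z≤n (hd<▹ (suc j) (machineCode (machine N)))) i≤n)
... | suc m , i≤n , at-stage = m , sparse-paths , h , pads , correct
  where
  M = machine N
  n = suc m
  e = machineCode M
  h = hist n
  time = clock (zeros n)
  pads = proj₂ (paddings (zeros n) time)
  sparse-paths = grows m (≤-pred (≤-trans (<⇒≤ (hd<▹ (suc j) e)) i≤n))
  open Diagonalisation N m sparse-paths h pads using (with-word; outOf; path-short; p; p<2^m)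
  open Diagonalisation N m sparse-paths h pads using (Correct)

  time-length : length time ≡ 2 ^ n
  time-length = ≡-trans (clock-length (zeros n)) (cong (2 ^_) (length-replicate n))

  -- At this stage the clock outlasts every path, so the clocked simulation is exact.
  p≤time : p ≤ length time
  p≤time = ≤-trans (<⇒≤ p<2^m) (≤-trans (^-monoʳ-≤ 2 (n≤1+n m)) (≤-reflexive (sym time-length)))

  results : Str → List Conf
  results w = outcomes e (zeros n) h w

  simulated : ∀ w o → outOf (with-word w) o → halted (outcomeNumber o) (results w) ≡ true
  simulated w o (t , r , ρ) = ≡-trans (cong (halted (outcomeNumber o)) (outcomes-code M n h w))
    (halted-complete M (oracle (zeros n) h w) time (zeros n) o (t , ≤-trans (path-short ρ) p≤time , r , ρ))

  realised : ∀ w o → halted (outcomeNumber o) (results w) ≡ true → outOf (with-word w) o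
  realised w o eq with halted-sound M (oracle (zeros n) h w) time (zeros n) o
    (≡-trans (sym (cong (halted (outcomeNumber o)) (outcomes-code M n h w))) eq)
  ... | t , _ , r , ρ = t , r , ρ

  Conforming = ∀ {w} → w ∈ allStrings (zeros n) → conforms w (results w) ≡ true

  conforming⇒correct : Conforming → Correct
  conforming⇒correct conf {w} w∈ with conforms⇒ {w} {results w} (conf w∈)
  ... | one , zero′ =
    (λ s → realised w acc (proj₁ (one s)) , proj₂ (one s) ∘ simulated w rej) ,
    (λ s → proj₁ (zero′ s) ∘ simulated w acc , realised w rej (proj₂ (zero′ s)))

  agree : ∀ {x} → length x < nextStage n → Agree langB (with-word (word n)) x × Agree (with-word (word n)) langB x
  agree {x} x< = (to , λ ¬b → ¬b ∘ from) , (from , λ ¬d → ¬d ∘ to)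
    where
    to : langB x → with-word (word n) x
    to b = subst (x ∈_) (stage-oracle at-stage) (langB⇒∈hist (nextStage n) x x< b)
    from : with-word (word n) x → langB x
    from d = ∈hist⇒langB (nextStage n) (subst (x ∈_) (sym (stage-oracle at-stage)) d)

  queries-short : ∀ {D t c} (ρ : Reach M D (initial M (zeros n)) t c) {x} → x ∈ queries ρ → length x < nextStage n
  queries-short {t = t} ρ {x} x∈ = begin-strict
    length x                           ≤⟨ queries-width ρ x∈ ⟩
    length (map (enc {k M}) (zeros n)) + t ≡⟨ cong (_+ t) (≡-trans (length-map enc (zeros n)) (length-replicate n)) ⟩
    n + t                              ≤⟨ +-monoʳ-≤ n (≤-trans (path-short ρ) p≤time) ⟩
    n + length time                    <⟨ n<1+n _ ⟩
    suc n + length time                ≡⟨ +-comm (suc n) (length time) ⟩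
    nextStage n                        ∎
    where open ≤-Reasoning

  with-word⇒langB : ∀ {o} → outOf (with-word (word n)) o → outOf langB o
  with-word⇒langB (t , r , ρ) = t , r , transfer ρ (λ x∈ → proj₂ (agree (queries-short ρ x∈)))

  langB⇒with-word : ∀ {o} → outOf langB o → outOf (with-word (word n)) o
  langB⇒with-word (t , r , ρ) = t , r , transfer ρ (λ x∈ → proj₁ (agree (queries-short ρ x∈)))

  -- The reduction is right on 0ⁿ with oracle B, and its paths there cannot tell B from the oracle
  -- of the simulation.
  word-conforms : conforms (word n) (results (word n)) ≡ true
  word-conforms with bool-cases (startsOne (word n))
  ... | inj₁ s = ≡-trans (conforms-one {word n} {results (word n)} s) (cong₂ (λ a b → a ∧ not b) accepted not-rejected)
    where
    accept = proj₁ (decides (zeros n)) (langA-zeros n s)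
    accepted = simulated (word n) acc (langB⇒with-word accept)
    not-rejected : halted 1 (results (word n)) ≡ false
    not-rejected with bool-cases (halted 1 (results (word n)))
    ... | inj₂ eq = eq
    ... | inj₁ eq = ⊥-elim (under (zeros n) (accept , with-word⇒langB (realised (word n) rej eq)))
  ... | inj₂ s = ≡-trans (conforms-zero {word n} {results (word n)} s) (cong₂ (λ a b → not a ∧ b) not-accepted rejected)
    where
    no-accept : ¬ outOf langB acc
    no-accept out with ≡-trans (sym (≡-trans (cong (startsOne ∘ word) (sym (length-replicate n)))
      (proj₂ (langA⇒ (zeros n) (proj₂ (decides (zeros n)) out))))) s
    ... | ()
    not-accepted : halted 0 (results (word n)) ≡ false
    not-accepted with bool-cases (halted 0 (results (word n)))
    ... | inj₂ eq = eq
    ... | inj₁ eq = ⊥-elim (no-accept (with-word⇒langB (realised (word n) acc eq)))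
    -- Overproductivity merely refutes the absence of both verdicts. Case distinction on the Boolean
    -- simulation result extracts the rejection.
    rejected : halted 1 (results (word n)) ≡ true
    rejected with bool-cases (halted 1 (results (word n)))
    ... | inj₁ eq = eq
    ... | inj₂ eq = ⊥-elim (over (zeros n) (no-accept , λ out → true≢false
      (≡-trans (sym (simulated (word n) rej (langB⇒with-word out))) eq)))
      where
      true≢false : true ≢ false
      true≢false ()

  word-picked : word n ≡ foldr (λ w v → if conforms w (results w) then v else w) (zeros n) (allStrings (zeros n))
  word-picked = ≡-trans (stage-word at-stage)
    (≡-trans (cong (λ e → diagonal e (zeros n) h) (tl-▹ (suc j) e)) (sym (diagonal-unfold e (zeros n) h)))

  -- `diagonal` returns a failing string whenever one exists. The string it returned here passes the
  -- test, so every string passes.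
  correct : Correct
  correct with pick-spec (λ w → conforms w (results w)) (zeros n) (allStrings (zeros n))
  ... | inj₁ (_ , all) = conforming⇒correct all
  ... | inj₂ (_ , wrong) with ≡-trans (sym word-conforms)
      (≡-trans (cong (λ w → conforms w (results w)) word-picked) wrong)
  ...   | ()

langA-≰O-langB : ¬ (langA ≤O langB)
langA-≰O-langB (N , over , via) with reduction-correct N via
... | m , sparse-paths , h , pads , correct =
  Diagonalisation.not-overproductive N m sparse-paths h pads correct over

langA-≰U-langB : ¬ (langA ≤U langB)
langA-≰U-langB (N , under , via) with reduction-correct N via
... | m , sparse-paths , h , pads , correct =
  Diagonalisation.not-underproductive N m sparse-paths h pads correct under

theorem4p2 : (Σ Lang λ A → Σ Lang λ B →
    Recursive A × Recursive B × Tally A × Sparse B ×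
    (A ≤SN B) × ¬ (A ≤O B))
    ×
    (Σ Lang λ A → Σ Lang λ B →
    Recursive A × Recursive B × Tally A × Sparse B ×
    (A ≤SN B) × ¬ (A ≤U B))
theorem4p2 =
  (langA , langB , langA-recursive , langB-recursive , langA-tally , langB-sparse ,
   langA-≤SN-langB , langA-≰O-langB) ,
  (langA , langB , langA-recursive , langB-recursive , langA-tally , langB-sparse ,
   langA-≤SN-langB , langA-≰U-langB)
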